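{- The (deterministic) competitive ratio of the infinite server problem on layered graphs of depth $D$ is exactly $1.5$ for $D=2$, exactly $2.5$ for $D=3$, and at least $3$ for $D\ge4$. That is: for $D=2$ (resp. $D=3$) there is an online algorithm that is $1.5$-competitive (resp. $2.5$-competitive) on every layered graph of depth $D$, and for every $\rho$ smaller than $1.5$ (resp. $2.5$, resp. $3$ when $D\ge4$) there is a layered graph of depth $D$ on which no deterministic online algorithm is $\rho$-competitive.
   Context: A layered graph of depth $D$ is a graph whose (possibly infinitely many) nodes are arranged in layers $0,1,\dots,D$ such that all edges run between adjacent layers, layer $0$ consists of a single node, and every node other than that one is adjacent to at least one node of the previous layer. Its metric is the shortest-path (number of edges) distance; the node of layer $0$ is the source. Infinite server problem: an unbounded number of servers initially reside at the source; a finite sequence of requests (nodes) is revealed one by one; each must be served immediately, without knowledge of future requests, by moving a server to it; the cost is the total distance traveled. An online algorithm is $\rho$-competitive if $ALG(\sigma)\le\rho\,OPT(\sigma)+c$ for all request sequences $\sigma$, with $c$ independent of $\sigma$. -}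

module Defs where

open import Axiom.ExcludedMiddle using (ExcludedMiddle)
open import Data.Integer using (+_)
open import Data.List using (List; []; _∷_)
open import Data.Nat using (ℕ; zero; suc; _+_; _≤_; _<_)
open import Data.Nat.Induction using (<-rec)
open import Data.Nat.Properties using (_≟_; ≮⇒≥; suc-injective)
open import Data.Product using (∃; ∃-syntax; _×_; _,_; proj₁)
open import Data.Rational as ℚ using (ℚ)
open import Data.Sum using (_⊎_)
open import Level using (0ℓ)
open import Relation.Binary.PropositionalEquality using (_≡_; _≢_; refl; sym; trans; subst)
open import Relation.Nullary using (yes; no)

-- Layers other than layer 0 may be empty here; see `ReachesDepth`.
record LayeredGraph (D : ℕ) : Set₁ where
  field
    Node         : Set
    _~_          : Node → Node → Set
    ~-sym        : ∀ {u v} → u ~ v → v ~ u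
    layer        : Node → ℕ
    layer≤D      : ∀ v → layer v ≤ D
    ~-layer      : ∀ {u v} → u ~ v → layer u ≡ suc (layer v) ⊎ layer v ≡ suc (layer u)
    source       : Node
    layer-source : layer source ≡ 0
    layer-unique : ∀ v → layer v ≡ 0 → v ≡ source
    parent       : ∀ v → v ≢ source → ∃[ u ] (u ~ v × layer v ≡ suc (layer u))

  data Walk : Node → Node → ℕ → Set where
    []  : ∀ {v} → Walk v v 0
    _∷_ : ∀ {u v w n} → u ~ v → Walk v w n → Walk u w (suc n)

  _++ʷ_ : ∀ {u v w m n} → Walk u v m → Walk v w n → Walk u w (m + n)
  []      ++ʷ q = q
  (e ∷ p) ++ʷ q = e ∷ (p ++ʷ q)

  walk-from-source : ∀ k v → layer v ≡ k → ∃ (Walk source v)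
  walk-from-source zero    v eq = 0 , subst (λ w → Walk source w 0) (sym (layer-unique v eq)) []
  walk-from-source (suc k) v eq with parent v (λ { refl → 0≢suc (trans (sym layer-source) eq) })
    where
    0≢suc : ∀ {n} → 0 ≢ suc n
    0≢suc ()
  ... | u , u~v , lv with walk-from-source k u (suc-injective (trans (sym lv) eq))
  ...   | n , p = n + 1 , (p ++ʷ (u~v ∷ []))

  reverseʷ : ∀ {u v n} → Walk u v n → ∃ (Walk v u)
  reverseʷ []      = 0 , []
  reverseʷ (e ∷ p) with reverseʷ p
  ... | n , q = n + 1 , (q ++ʷ (~-sym e ∷ []))

  connected : ∀ u v → ∃ (Walk u v)
  connected u v with walk-from-source (layer u) u refl | walk-from-source (layer v) v refl
  ... | _ , p | n , q with reverseʷ p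
  ...   | m , p′ = m + n , (p′ ++ʷ q)

ReachesDepth : ∀ D → LayeredGraph D → Set
ReachesDepth D G = ∃[ v ] LayeredGraph.layer G v ≡ D

IsLeast : (ℕ → Set) → ℕ → Set
IsLeast P n = P n × (∀ m → P m → n ≤ m)

-- Graphs are arbitrary, with no decidability assumed, so the minima defining
-- distances and optimal costs exist only classically.
least : ExcludedMiddle 0ℓ → (P : ℕ → Set) → ∃ P → ∃ (IsLeast P)
least em P (n₀ , p₀) = <-rec (λ n → P n → ∃ (IsLeast P)) go n₀ p₀
  where
  go : ∀ n → (∀ {k} → k < n → P k → ∃ (IsLeast P)) → P n → ∃ (IsLeast P)
  go n rec pn with em {∃[ k ] (k < n × P k)}
  ... | yes (k , k<n , pk) = rec k<n pk
  ... | no none            = n , pn , λ m pm → ≮⇒≥ (λ m<n → none (m , m<n , pm))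

module InfiniteServer (em : ExcludedMiddle 0ℓ) {D : ℕ} (G : LayeredGraph D) where
  open LayeredGraph G

  shortest : ∀ u v → ∃ (IsLeast (Walk u v))
  shortest u v = least em (Walk u v) (connected u v)

  dist : Node → Node → ℕ
  dist u v = proj₁ (shortest u v)

  Config : Set
  Config = ℕ → Node

  initial : Config
  initial _ = source

  _[_↦_] : Config → ℕ → Node → Config
  (C [ s ↦ v ]) t with s ≟ t
  ... | yes _ = v
  ... | no  _ = C t

  -- Any finite number of server movements (server, destination), made in order
  -- in response to one request.
  Moves : Set
  Moves = List (ℕ × Node)

  execute : Config → Moves → Config
  execute C []             = C
  execute C ((s , v) ∷ ms) = execute (C [ s ↦ v ]) ms

  travel : Config → Moves → ℕ
  travel C []             = 0
  travel C ((s , v) ∷ ms) = dist (C s) v + travel (C [ s ↦ v ]) ms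

  Occupied : Config → Node → Set
  Occupied C r = ∃[ s ] C s ≡ r

  -- Request sequences are listed with the most recent request first.
  Requests : Set
  Requests = List Node

  -- `Service σ C n`: σ can be served at total cost n, ending in C.
  data Service : Requests → Config → ℕ → Set where
    start : Service [] initial 0
    serve : ∀ {σ C n} → Service σ C n →
            ∀ r ms → Occupied (execute C ms) r →
            Service (r ∷ σ) (execute C ms) (n + travel C ms)

  ServableAt : Requests → ℕ → Set
  ServableAt σ n = ∃[ C ] Service σ C n

  servable : ∀ σ → ∃ (ServableAt σ)
  servable []      = 0 , initial , start
  servable (r ∷ σ) with servable σ
  ... | n , C , S = _ , _ , serve S r ((0 , r) ∷ []) (0 , refl)

  optimal : ∀ σ → ∃ (IsLeast (ServableAt σ))
  optimal σ = least em (ServableAt σ) (servable σ)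

  OPT : Requests → ℕ
  OPT σ = proj₁ (optimal σ)

  configAfter : (Requests → Node → Moves) → Requests → Config
  configAfter respond []      = initial
  configAfter respond (r ∷ σ) = execute (configAfter respond σ) (respond σ r)

  -- The moves depend only on the past requests and the current one.
  record OnlineAlgorithm : Set where
    field
      respond : (past : Requests) (current : Node) → Moves
      serves  : ∀ σ r → Occupied (configAfter respond (r ∷ σ)) r

    ALG : Requests → ℕ
    ALG []      = 0
    ALG (r ∷ σ) = ALG σ + travel (configAfter respond σ) (respond σ r)

  open OnlineAlgorithm public using (ALG)

  fromℕ : ℕ → ℚ
  fromℕ n = + n ℚ./ 1

  Competitive : ℚ → OnlineAlgorithm → Set
  Competitive ρ A = ∃[ c ] (∀ σ → fromℕ (ALG A σ) ℚ.≤ ρ ℚ.* fromℕ (OPT σ) ℚ.+ c)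

{-# OPTIONS --safe #-}

-- Upper bound: sending a fresh server from the source to every new node costs
-- Σ layer v over the distinct requested nodes v. Any schedule enters each of them
-- at cost at least 1, and enters each node of the last layer D at amortised cost 2
-- (the potential counts servers in layer D - 1), so 2 ALG ≤ (2 D - 1) OPT.
--
-- Lower bound: the adversary zigzags between the last two layers. OPT holds q outer
-- nodes W. In each phase n fresh inner nodes adjacent to all of W are requested,
-- then n fresh outer nodes, each adjacent to two inner nodes. OPT pays 1 for each
-- by moving a server across one edge. If the online algorithm also moves a server
-- across one edge, the vacated node is requested again: OPT may still be there,
-- since which n servers of W it used is decided at the end of the phase, and which
-- of the two inner nodes is given up is decided after the algorithm's move. With
-- β, δ the amortised prices of reaching an outer and an inner node, the algorithm
-- pays δ for every inner and β + δ for every outer request but the last, hence the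
-- ratio tends to (β + 2 δ) / 2, which is 3/2, 5/2 and 3 for D = 2, D = 3 and D ≥ 4.
module Submission where

open import Defs
open import Axiom.ExcludedMiddle using (ExcludedMiddle)
open import Data.Bool using (Bool; true; not)
open import Data.Bool.Properties using (not-involutive; not-¬)
open import Data.Empty using (⊥)
open import Data.Integer as ℤ using (ℤ; +_; -[1+_])
import Data.Integer.Properties as ℤ
import Data.Integer.Tactic.RingSolver as ℤ-Solver
open import Data.List using (List; []; _∷_; map; length; _++_)
open import Data.List.Membership.Propositional using (_∈_; _∉_)
open import Data.List.Membership.Propositional.Properties using (∈-∃++; ∈-++⁻; ∈-++⁺ˡ; ∈-++⁺ʳ)
open import Data.List.Relation.Binary.Permutation.Propositional.Properties using (map⁺; shift; ↭-length)
open import Data.List.Relation.Unary.All as All using (All; []; _∷_)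
open import Data.List.Relation.Unary.AllPairs using ([]; _∷_)
open import Data.List.Relation.Unary.Any using (here; there)
open import Data.List.Relation.Unary.Unique.Propositional using (Unique)
open import Data.Maybe using (Maybe; just; nothing; maybe)
open import Data.Nat hiding (_/_)
open import Data.Nat.ListAction using (sum)
open import Data.Nat.ListAction.Properties using (sum-↭)
open import Data.Nat.Properties
open import Data.Nat.Tactic.RingSolver using (solve-∀)
open import Data.Product using (∃-syntax; Σ-syntax; _×_; _,_; proj₁; proj₂; map₁; map₂)
open import Data.Rational as ℚ using (ℚ; 0ℚ; _/_; ↥_; ↧_; ↧ₙ_; toℚᵘ)
import Data.Rational.Properties as ℚ
open import Data.Rational.Unnormalised as ℚᵘ using (mkℚᵘ; *≤*)
import Data.Rational.Unnormalised.Properties as ℚᵘ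
open import Data.Sum using (_⊎_; inj₁; inj₂; swap)
open import Data.List.Membership.DecPropositional _≟_ using (_∈?_)
open import Level using (0ℓ)
open import Relation.Binary.PropositionalEquality
open import Relation.Nullary

-- Finite sums and potentials summed over all servers.

Σ< : ℕ → (ℕ → ℕ) → ℕ
Σ< zero    g = 0
Σ< (suc N) g = g N + Σ< N g

Σ<-zero : ∀ {g} N → (∀ t → g t ≡ 0) → Σ< N g ≡ 0
Σ<-zero zero    z = refl
Σ<-zero (suc N) z = cong₂ _+_ (z N) (Σ<-zero N z)

Σ<-cong : ∀ {g h} N → (∀ t → t < N → h t ≡ g t) → Σ< N h ≡ Σ< N g
Σ<-cong zero    eq = refl
Σ<-cong (suc N) eq = cong₂ _+_ (eq N ≤-refl) (Σ<-cong N (λ t t<N → eq t (m<n⇒m<1+n t<N)))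

Σ<-≤ : ∀ g N k → Σ< N g ≤ Σ< (k + N) g
Σ<-≤ g N zero    = ≤-refl
Σ<-≤ g N (suc k) = ≤-trans (Σ<-≤ g N k) (m≤n+m _ _)

Σ<-update : ∀ {g h s} N → s < N → (∀ t → t ≢ s → h t ≡ g t) → Σ< N h + g s ≡ Σ< N g + h s
Σ<-update {g} {h} {s} (suc N) s<1+N eq with s ≟ N
... | yes refl = begin
  h s + Σ< s h + g s ≡⟨ cong (λ z → h s + z + g s) (Σ<-cong s (λ t t<s → eq t (<⇒≢ t<s))) ⟩
  h s + Σ< s g + g s ≡⟨ swap-ends (h s) (Σ< s g) (g s) ⟩
  g s + Σ< s g + h s ∎
  where
  open ≡-Reasoning
  swap-ends : ∀ a b c → a + b + c ≡ c + b + a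
  swap-ends = solve-∀
... | no s≢N = begin
  h N + Σ< N h + g s   ≡⟨ +-assoc (h N) _ _ ⟩
  h N + (Σ< N h + g s) ≡⟨ cong₂ _+_ (eq N (≢-sym s≢N)) (Σ<-update N (≤∧≢⇒< (≤-pred s<1+N) s≢N) eq) ⟩
  g N + (Σ< N g + h s) ≡⟨ +-assoc (g N) _ _ ⟨
  g N + Σ< N g + h s   ∎
  where open ≡-Reasoning

-- Potentials over all servers are bounded through every finite partial sum, so
-- no bound on the indices of the moved servers has to be carried along.
Within : (ℕ → ℕ) → ℕ → ℕ → Set
Within g x y = ∀ N → Σ< N g + x ≤ y

-- A partial sum up to `N` may miss the changed index `s`, so it is first lengthened to `N + suc s`,
-- where `Σ<-update` applies.
within-update : ∀ {g h s x y d e} → Within g x y → (∀ t → t ≢ s → h t ≡ g t) →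
                h s + d ≤ g s + e → Within h (x + d) (y + e)
within-update {g} {h} {s} {x} {y} {d} {e} wi eq le N = +-cancelʳ-≤ (g s) _ _ (begin
  Σ< N h + (x + d) + g s           ≤⟨ +-monoˡ-≤ (g s) (+-monoˡ-≤ (x + d) Σ<-grows) ⟩
  Σ< (N + suc s) h + (x + d) + g s ≡⟨ r₁ (Σ< (N + suc s) h) (x + d) (g s) ⟩
  Σ< (N + suc s) h + g s + (x + d) ≡⟨ cong (_+ (x + d)) (Σ<-update (N + suc s) (m≤n+m (suc s) N) eq) ⟩
  Σ< (N + suc s) g + h s + (x + d) ≡⟨ r₂ (Σ< (N + suc s) g) (h s) x d ⟩
  Σ< (N + suc s) g + x + (h s + d) ≤⟨ +-mono-≤ (wi (N + suc s)) le ⟩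
  y + (g s + e)                    ≡⟨ r₃ y (g s) e ⟩
  y + e + g s                      ∎)
  where
  open ≤-Reasoning
  Σ<-grows : Σ< N h ≤ Σ< (N + suc s) h
  Σ<-grows = subst (λ k → Σ< N h ≤ Σ< k h) (+-comm (suc s) N) (Σ<-≤ h N (suc s))
  r₁ : ∀ a b c → a + b + c ≡ a + c + b
  r₁ = solve-∀
  r₂ : ∀ a b c d → a + b + (c + d) ≡ a + c + (b + d)
  r₂ = solve-∀
  r₃ : ∀ a b c → a + (b + c) ≡ a + c + b
  r₃ = solve-∀

within-cong : ∀ {g h x y} → Within g x y → (∀ t → h t ≡ g t) → Within h x y
within-cong {x = x} {y} wi eq N = subst (λ z → z + x ≤ y) (sym (Σ<-cong N (λ t _ → eq t))) (wi N)

within-weaken : ∀ {g x x′ y} → x′ ≤ x → Within g x y → Within g x′ y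
within-weaken {g} le wi N = ≤-trans (+-monoʳ-≤ (Σ< N g) le) (wi N)

-- Walks, layers and lower bounds on distances.

isEven : ℕ → Bool
isEven zero    = true
isEven (suc n) = not (isEven n)

module Walks {D} (G : LayeredGraph D) where
  open LayeredGraph G

  walk-layer : ∀ {u v n} → Walk u v n → layer v ≤ n + layer u
  walk-layer [] = ≤-refl
  walk-layer {u} {n = suc n} (_∷_ {v = v} e p) = ≤-trans (walk-layer p) (≤-trans (+-monoʳ-≤ n layer≤) (≤-reflexive (+-suc n _)))
    where
    layer≤ : layer v ≤ suc (layer u)
    layer≤ with ~-layer e
    ... | inj₁ eq = ≤-trans (n≤1+n _) (≤-trans (≤-reflexive (sym eq)) (n≤1+n _))
    ... | inj₂ eq = ≤-reflexive eq

  -- Every edge changes the layer by exactly one. This excludes walks of length 3 within a layer and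
  -- of length 2 between adjacent layers, whence the distance bounds 4 and 3 below.
  walk-parity : ∀ {u v n} → Walk u v n → isEven (n + layer u) ≡ isEven (layer v)
  walk-parity [] = refl
  walk-parity {u} {w} {suc n} (_∷_ {v = v} e p) with ~-layer e
  ... | inj₁ eq = trans (cong (λ k → not (isEven (n + k))) eq)
                 (trans (cong (λ k → not (isEven k)) (+-suc n (layer v)))
                 (trans (not-involutive _) (walk-parity p)))
  ... | inj₂ eq = trans (sym (cong isEven (trans (cong (λ k → n + k) eq) (+-suc n (layer u))))) (walk-parity p)

  source-walk : ∀ k v → layer v ≡ k → Walk source v k
  source-walk zero    v eq = subst (λ w → Walk source w 0) (sym (layer-unique v eq)) []
  source-walk (suc k) v eq with parent v (λ { refl → 0≢1+n (trans (sym layer-source) eq) })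
  ... | u , u~v , lv = subst (Walk source v) (+-comm k 1)
                         (source-walk k u (suc-injective (trans (sym lv) eq)) ++ʷ (u~v ∷ []))

module Servers (em : ExcludedMiddle 0ℓ) {D} (G : LayeredGraph D) where
  open LayeredGraph G
  open InfiniteServer em G
  open Walks G

  dist-walk : ∀ u v → Walk u v (dist u v)
  dist-walk u v = proj₁ (proj₂ (shortest u v))

  dist-≤ : ∀ {u v n} → Walk u v n → dist u v ≤ n
  dist-≤ {u} {v} p = proj₂ (proj₂ (shortest u v)) _ p

  dist-self : ∀ v → dist v v ≡ 0
  dist-self v = n≤0⇒n≡0 (dist-≤ [])

  dist-triangle : ∀ u v w → dist u w ≤ dist u v + dist v w
  dist-triangle u v w = dist-≤ (dist-walk u v ++ʷ dist-walk v w)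

  layer≤dist : ∀ v → layer v ≤ dist source v
  layer≤dist v = ≤-trans (walk-layer (dist-walk source v))
    (≤-reflexive (trans (cong (λ k → dist source v + k) layer-source) (+-identityʳ _)))

  dist-source≤layer : ∀ v → dist source v ≤ layer v
  dist-source≤layer v = dist-≤ (source-walk (layer v) v refl)

  no-short-walk⇒≤dist : ∀ {u v b} → (∀ n → n < b → ¬ Walk u v n) → b ≤ dist u v
  no-short-walk⇒≤dist {u} {v} none = ≮⇒≥ (λ lt → none _ lt (dist-walk u v))

  ≢⇒1≤dist : ∀ {u v} → u ≢ v → 1 ≤ dist u v
  ≢⇒1≤dist u≢v = no-short-walk⇒≤dist λ { zero _ [] → u≢v refl ; (suc n) (s≤s ()) _ }

  same-layer-≁ : ∀ {u v} → layer u ≡ layer v → ¬ (u ~ v)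
  same-layer-≁ eq e with ~-layer e
  ... | inj₁ lu = 1+n≢n (trans (sym lu) eq)
  ... | inj₂ lv = 1+n≢n (trans (sym lv) (sym eq))

  same-layer⇒2≤dist : ∀ {u v} → layer u ≡ layer v → u ≢ v → 2 ≤ dist u v
  same-layer⇒2≤dist eq u≢v = no-short-walk⇒≤dist λ where
    0 _ []       → u≢v refl
    1 _ (e ∷ []) → same-layer-≁ eq e
    (suc (suc n)) (s≤s (s≤s ())) _

  same-layer-≁²⇒4≤dist : ∀ {u v} → layer u ≡ layer v → u ≢ v →
                          (∀ w → u ~ w → ¬ (w ~ v)) → 4 ≤ dist u v
  same-layer-≁²⇒4≤dist {u} {v} eq u≢v far = no-short-walk⇒≤dist λ where
    0 _ []           → u≢v refl
    1 _ (e ∷ [])     → same-layer-≁ eq e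
    2 _ (e ∷ f ∷ []) → far _ e f
    3 _ p            → not-¬ refl (sym (trans (sym (not-involutive _)) (trans (walk-parity p) (cong isEven (sym eq)))))
    (suc (suc (suc (suc n)))) (s≤s (s≤s (s≤s (s≤s ())))) _

  other-layer-≁⇒3≤dist : ∀ {u v} → layer u ≡ suc (layer v) ⊎ layer v ≡ suc (layer u) →
                          ¬ (u ~ v) → 3 ≤ dist u v
  other-layer-≁⇒3≤dist {u} {v} eq u≁v = no-short-walk⇒≤dist none
    where
    same : ∀ {w} → ¬ (layer w ≡ suc (layer w) ⊎ layer w ≡ suc (layer w))
    same (inj₁ x) = 1+n≢n (sym x)
    same (inj₂ x) = 1+n≢n (sym x)
    flipped : layer u ≡ suc (layer v) ⊎ layer v ≡ suc (layer u) → isEven (layer u) ≢ isEven (layer v)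
    flipped (inj₁ x) p = not-¬ refl (trans (sym p) (cong isEven x))
    flipped (inj₂ x) p = not-¬ refl (trans p (cong isEven x))
    none : ∀ n → n < 3 → ¬ Walk u v n
    none 0 _ []       = same eq
    none 1 _ (e ∷ []) = u≁v e
    none 2 _ p        = flipped eq (trans (sym (not-involutive _)) (walk-parity p))
    none (suc (suc (suc n))) (s≤s (s≤s (s≤s ()))) _

  moved : ∀ C s v → (C [ s ↦ v ]) s ≡ v
  moved C s v with s ≟ s
  ... | yes _  = refl
  ... | no s≢s = contradiction refl s≢s

  unmoved : ∀ C s v {t} → t ≢ s → (C [ s ↦ v ]) t ≡ C t
  unmoved C s v {t} t≢s with s ≟ t
  ... | yes s≡t = contradiction (sym s≡t) t≢s
  ... | no _    = refl

-- Upper bound by fresh servers.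

-- One occurrence of `x` is deleted from `ys`; uniqueness ensures that the rest of `xs` does not
-- need it.
sum-⊆ : ∀ {A : Set} (f : A → ℕ) {xs} ys → Unique xs → (∀ {x} → x ∈ xs → x ∈ ys) →
        sum (map f xs) ≤ sum (map f ys)
sum-⊆ f ys []        sub = z≤n
sum-⊆ f {x ∷ xs} ys (x∉ ∷ uniq) sub with ∈-∃++ (sub (here refl))
... | as , bs , refl = ≤-trans (+-monoʳ-≤ (f x) (sum-⊆ f (as ++ bs) uniq sub′))
                               (≤-reflexive (sym (sum-↭ (map⁺ f (shift x as bs)))))
  where
  sub′ : ∀ {y} → y ∈ xs → y ∈ as ++ bs
  sub′ y∈ with ∈-++⁻ as (sub (there y∈))
  ... | inj₁ y∈as          = ∈-++⁺ˡ y∈as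
  ... | inj₂ (here refl)   = contradiction refl (All.lookup x∉ y∈)
  ... | inj₂ (there y∈bs)  = ∈-++⁺ʳ as y∈bs

module FreshServers (em : ExcludedMiddle 0ℓ) {E} (1≤E : 1 ≤ E) (G : LayeredGraph (suc E)) where
  open LayeredGraph G
  open InfiniteServer em G
  open Servers em G

  -- The index `length σ` is new at every request, so this server still stands at the source. For
  -- the same reason the source is always covered and counts as already requested.
  respond : Requests → Node → Moves
  respond σ r with em {r ∈ source ∷ σ}
  ... | yes _ = []
  ... | no  _ = (length σ , r) ∷ []

  distinct : Requests → List Node
  distinct []      = []
  distinct (r ∷ σ) with em {r ∈ source ∷ σ}
  ... | yes _ = distinct σ
  ... | no  _ = r ∷ distinct σ

  idle : ∀ σ s → length σ ≤ s → configAfter respond σ s ≡ source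
  idle []      s le = refl
  idle (r ∷ σ) s le with em {r ∈ source ∷ σ}
  ... | yes _ = idle σ s (≤-trans (n≤1+n _) le)
  ... | no  _ = trans (unmoved (configAfter respond σ) (length σ) r (≢-sym (<⇒≢ le))) (idle σ s (≤-trans (n≤1+n _) le))

  -- A server stays where it was sent. The bound `s < length σ` tells it apart from the server used
  -- for the next request.
  visited : ∀ σ {v} → v ∈ σ → v ≢ source → ∃[ s ] s < length σ × configAfter respond σ s ≡ v
  visited (r ∷ σ) v∈ v≢ with em {r ∈ source ∷ σ}
  visited (r ∷ σ) (here refl) v≢ | yes (here refl) = contradiction refl v≢
  visited (r ∷ σ) (here refl) v≢ | yes (there r∈)  = map₂ (map₁ m<n⇒m<1+n) (visited σ r∈ v≢)
  visited (r ∷ σ) (there v∈)  v≢ | yes _           = map₂ (map₁ m<n⇒m<1+n) (visited σ v∈ v≢)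
  visited (r ∷ σ) (here refl) v≢ | no _ = length σ , ≤-refl , moved (configAfter respond σ) (length σ) r
  visited (r ∷ σ) (there v∈)  v≢ | no _ with visited σ v∈ v≢
  ... | s , s<∣σ∣ , eq = s , m<n⇒m<1+n s<∣σ∣ , trans (unmoved (configAfter respond σ) (length σ) r (<⇒≢ s<∣σ∣)) eq

  covered : ∀ σ {v} → v ∈ source ∷ σ → Occupied (configAfter respond σ) v
  covered σ (here refl) = length σ , idle σ (length σ) ≤-refl
  covered σ {v} (there v∈) with em {v ≡ source}
  ... | yes refl = length σ , idle σ (length σ) ≤-refl
  ... | no v≢    = map₂ proj₂ (visited σ v∈ v≢)

  serves : ∀ σ r → Occupied (configAfter respond (r ∷ σ)) r
  serves σ r = covered (r ∷ σ) (there (here refl))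

  algorithm : OnlineAlgorithm
  algorithm = record { respond = respond ; serves = serves }

  weight : List Node → ℕ
  weight vs = sum (map layer vs)

  ALG≤weight : ∀ σ → ALG algorithm σ ≤ weight (distinct σ)
  ALG≤weight []      = z≤n
  ALG≤weight (r ∷ σ) with em {r ∈ source ∷ σ}
  ... | yes _ = ≤-trans (≤-reflexive (+-identityʳ _)) (ALG≤weight σ)
  ... | no  _ = begin
    ALG algorithm σ + (dist (configAfter respond σ (length σ)) r + 0) ≡⟨ cong (λ v → ALG algorithm σ + (dist v r + 0)) (idle σ (length σ) ≤-refl) ⟩
    ALG algorithm σ + (dist source r + 0)                             ≤⟨ +-mono-≤ (ALG≤weight σ) (≤-trans (≤-reflexive (+-identityʳ _)) (dist-source≤layer r)) ⟩
    weight (distinct σ) + layer r                                     ≡⟨ +-comm _ (layer r) ⟩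
    layer r + weight (distinct σ)                                     ∎
    where open ≤-Reasoning

  distinct-⊆ : ∀ σ {v} → v ∈ distinct σ → v ∈ σ × v ≢ source
  distinct-⊆ (r ∷ σ) v∈ with em {r ∈ source ∷ σ}
  distinct-⊆ (r ∷ σ) v∈          | yes _ = map₁ there (distinct-⊆ σ v∈)
  distinct-⊆ (r ∷ σ) (here refl) | no r∉ = here refl , λ { refl → r∉ (here refl) }
  distinct-⊆ (r ∷ σ) (there v∈)  | no _  = map₁ there (distinct-⊆ σ v∈)

  distinct-unique : ∀ σ → Unique (distinct σ)
  distinct-unique []      = []
  distinct-unique (r ∷ σ) with em {r ∈ source ∷ σ}
  ... | yes _ = distinct-unique σ
  ... | no r∉ = All.tabulate (λ { v∈ refl → r∉ (there (proj₁ (distinct-⊆ σ v∈))) }) ∷ distinct-unique σ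

  -- A server one layer above the bottom may reach the bottom by a single edge;
  -- it has saved for that step when it was moved there.
  φ : Node → ℕ
  φ v with layer v ≟ E
  ... | yes _ = 1
  ... | no  _ = 0

  φ-no : ∀ {v} → layer v ≢ E → φ v ≡ 0
  φ-no {v} neq with layer v ≟ E
  ... | yes eq = contradiction eq neq
  ... | no _   = refl

  rate : ℕ
  rate = suc (2 * E)

  rate≤ : ∀ {u v} → u ≢ v → rate ≤ rate * dist u v
  rate≤ u≢v = ≤-trans (≤-reflexive (sym (*-identityʳ rate))) (*-monoʳ-≤ rate (≢⇒1≤dist u≢v))

  -- Only the bottom layer is critical, where `2 * layer v` is `1 + rate`: either `u` lies in layer
  -- `E` and has saved the missing unit, or `u` is not adjacent to `v` and the distance is at least
  -- 2.
  move-bound : ∀ {u v} → u ≢ v → φ v + 2 * layer v ≤ φ u + rate * dist u v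
  move-bound {u} {v} u≢v with layer v ≟ E
  ... | yes eq = ≤-trans (≤-reflexive (cong (λ k → suc (2 * k)) eq)) (≤-trans (rate≤ u≢v) (m≤n+m _ (φ u)))
  ... | no neq with layer v ≟ suc E
  ...   | no neq′ = ≤-trans (*-monoʳ-≤ 2 (≤-pred (≤∧≢⇒< (layer≤D v) neq′))) (≤-trans (n≤1+n _) (≤-trans (rate≤ u≢v) (m≤n+m _ (φ u))))
  ...   | yes eq with layer u ≟ E
  ...     | yes _ = begin
    2 * layer v           ≡⟨ cong (2 *_) eq ⟩
    2 * suc E             ≡⟨ *-suc 2 E ⟩
    1 + rate              ≤⟨ s≤s (rate≤ u≢v) ⟩
    1 + rate * dist u v   ∎
    where open ≤-Reasoning
  ...     | no neqᵤ = begin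
    2 * layer v    ≡⟨ cong (2 *_) eq ⟩
    2 * suc E      ≤⟨ *-monoʳ-≤ 2 (s≤s (m≤m+n E (E + 0))) ⟩
    2 * rate       ≡⟨ *-comm 2 rate ⟩
    rate * 2       ≤⟨ *-monoʳ-≤ rate far ⟩
    rate * dist u v ∎
    where
    open ≤-Reasoning
    not-adjacent : ¬ (u ~ v)
    not-adjacent e with ~-layer e
    ... | inj₁ lu = <⇒≱ (≤-reflexive (cong suc (sym eq))) (≤-trans (≤-reflexive (sym lu)) (layer≤D u))
    ... | inj₂ lv = neqᵤ (suc-injective (trans (sym lv) eq))
    far : 2 ≤ dist u v
    far = no-short-walk⇒≤dist λ where
      0 _ []       → u≢v refl
      1 _ (e ∷ []) → not-adjacent e
      (suc (suc n)) (s≤s (s≤s ())) _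

  Visited : Config → List Node → Set
  Visited C vs = ∀ s → C s ∈ source ∷ vs

  Paid : Config → List Node → ℕ → Set
  Paid C vs n = Within (λ s → φ (C s)) (2 * weight vs) (rate * n)

  -- `ws` lists the entered nodes with repetitions, so a move only prepends its target. Moves that
  -- stay in place are free and are skipped, as `move-bound` needs distinct endpoints.
  execute-paid : ∀ {C vs n} ms → Visited C vs → Paid C vs n →
    ∃[ ws ] (∀ {v} → v ∈ vs → v ∈ ws) × Visited (execute C ms) ws × Paid (execute C ms) ws (n + travel C ms)
  execute-paid {C} {vs} {n} [] vis paid = vs , (λ v∈ → v∈) , vis , subst (Paid C vs) (sym (+-identityʳ n)) paid
  execute-paid {C} {vs} {n} ((s , v) ∷ ms) vis paid with em {C s ≡ v}
  ... | yes refl = let ws , sub , vis″ , paid″ = execute-paid ms vis′ paid′ in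
                   ws , sub , vis″ , subst (Paid _ ws) (+-assoc n _ _) paid″
    where
    same : ∀ t → (C [ s ↦ C s ]) t ≡ C t
    same t with s ≟ t
    ... | yes refl = refl
    ... | no _     = refl
    vis′ : Visited (C [ s ↦ C s ]) vs
    vis′ t = subst (_∈ source ∷ vs) (sym (same t)) (vis t)
    paid′ : Paid (C [ s ↦ C s ]) vs (n + dist (C s) (C s))
    paid′ = within-cong (subst (λ k → Paid C vs k) (sym (trans (cong (λ k → n + k) (dist-self (C s))) (+-identityʳ n))) paid) (λ t → cong φ (same t))
  ... | no Cs≢v = let ws , sub , vis″ , paid″ = execute-paid ms vis′ paid′ in
                  ws , (λ v∈ → sub (there v∈)) , vis″ , subst (Paid _ ws) (+-assoc n _ _) paid″
    where
    vis′ : Visited (C [ s ↦ v ]) (v ∷ vs)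
    vis′ t with s ≟ t
    ... | yes _ = there (here refl)
    ... | no _ with vis t
    ...   | here eq  = here eq
    ...   | there t∈ = there (there t∈)
    paid′ : Paid (C [ s ↦ v ]) (v ∷ vs) (n + dist (C s) v)
    paid′ = subst₂ (Within (λ t → φ ((C [ s ↦ v ]) t))) (r (weight vs) (layer v)) (sym (*-distribˡ-+ rate n _))
      (within-update paid (λ t t≢s → cong φ (unmoved C s v t≢s))
        (≤-trans (≤-reflexive (cong (λ w → φ w + 2 * layer v) (moved C s v))) (move-bound Cs≢v)))
      where
      r : ∀ a b → 2 * a + 2 * b ≡ 2 * (b + a)
      r = solve-∀

  service-paid : ∀ {σ C n} → Service σ C n →
    ∃[ vs ] (∀ {v} → v ∈ σ → v ∈ source ∷ vs) × Visited C vs × Paid C vs n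
  -- `1 ≤ E` keeps the source out of layer `E`, so the initial potential is zero.
  service-paid start = [] , (λ ()) , (λ _ → here refl) , λ N →
    ≤-trans (≤-reflexive (trans (+-identityʳ _) (Σ<-zero N (λ _ → φ-no (λ eq → <⇒≢ 1≤E (trans (sym layer-source) eq)))))) z≤n
  service-paid (serve S r ms (s , at)) with service-paid S
  ... | vs , sub , vis , paid with execute-paid ms vis paid
  ...   | ws , sub′ , vis′ , paid′ = ws , sub″ , vis′ , paid′
    where
    sub″ : ∀ {v} → v ∈ r ∷ _ → v ∈ source ∷ ws
    sub″ (here refl) = subst (_∈ source ∷ ws) at (vis′ s)
    sub″ (there v∈) with sub v∈
    ... | here eq  = here eq
    ... | there v∈′ = there (sub′ v∈′)

  competitive : ∀ σ → 2 * ALG algorithm σ ≤ rate * OPT σ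
  competitive σ with service-paid (proj₂ (proj₁ (proj₂ (optimal σ))))
  -- `paid 0` is the empty partial sum, which discards the potential.
  ... | vs , sub , _ , paid = ≤-trans (*-monoʳ-≤ 2 (≤-trans (ALG≤weight σ) (sum-⊆ layer vs (distinct-unique σ) distinct⊆vs))) (paid 0)
    where
    distinct⊆vs : ∀ {v} → v ∈ distinct σ → v ∈ vs
    distinct⊆vs v∈ with distinct-⊆ σ v∈
    ... | v∈σ , v≢source with sub v∈σ
    ...   | here eq   = contradiction eq v≢source
    ...   | there v∈′ = v∈′

-- The graph of the lower bound and the prices of moves in it.

module Arena (m q : ℕ) where

  -- In outer c (k , i , j), the round k only serves to tell nodes with the same
  -- neighbours inner c i and inner c j apart.
  Label : Set
  Label = ℕ × ℕ × ℕ

  -- The history of the completed phases: `f s` is the label of the outer node at which offline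
  -- server `s` ended a phase, or `nothing` if it kept its place. Thus `W c s` is where it stands
  -- when phase `c` begins.
  data Context : Set where
    root : Context
    next : Context → (ℕ → Maybe Label) → Context

  data Node : Set where
    spine : ∀ i → i ≤ m → Node
    hub   : Node
    base  : ℕ → Node
    inner : Context → ℕ → Node
    outer : Context → Label → Node

  W : Context → ℕ → Node
  W root       s = base s
  W (next c f) s = maybe (outer c) (W c s) (f s)

  -- Edges are oriented away from the source. The endpoint in `inner-W` is a variable with an
  -- equation, because `W c s` is computed and could block pattern matching.
  data _⊲_ : Node → Node → Set where
    spine-spine : ∀ {i i≤m 1+i≤m} → spine i i≤m ⊲ spine (suc i) 1+i≤m
    spine-hub   : ∀ {m≤m} → spine m m≤m ⊲ hub
    hub-base    : ∀ {s} → hub ⊲ base s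
    spine-inner : ∀ {m≤m c l} → spine m m≤m ⊲ inner c l
    inner-W     : ∀ {c l s v} → s < q → v ≡ W c s → inner c l ⊲ v
    inner-outer₁ : ∀ {c k i j} → inner c i ⊲ outer c (k , i , j)
    inner-outer₂ : ∀ {c k i j} → inner c j ⊲ outer c (k , i , j)

  layer : Node → ℕ
  layer (spine i _) = i
  layer hub         = suc m
  layer (base _)    = suc (suc m)
  layer (inner _ _) = suc m
  layer (outer _ _) = suc (suc m)

  layer-W : ∀ c s → layer (W c s) ≡ suc (suc m)
  layer-W root       s = refl
  layer-W (next c f) s with f s
  ... | just _  = refl
  ... | nothing = layer-W c s

  ⊲-layer : ∀ {u v} → u ⊲ v → layer v ≡ suc (layer u)
  ⊲-layer spine-spine  = refl
  ⊲-layer spine-hub    = refl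
  ⊲-layer hub-base     = refl
  ⊲-layer spine-inner  = refl
  ⊲-layer (inner-W {c} {s = s} _ refl) = layer-W c s
  ⊲-layer inner-outer₁ = refl
  ⊲-layer inner-outer₂ = refl

  source : Node
  source = spine 0 z≤n

  G : LayeredGraph (suc (suc m))
  G = record
    { Node = Node
    ; _~_ = λ u v → u ⊲ v ⊎ v ⊲ u
    ; ~-sym = swap
    ; layer = layer
    ; layer≤D = bounded
    ; ~-layer = λ { (inj₁ e) → inj₂ (⊲-layer e) ; (inj₂ e) → inj₁ (⊲-layer e) }
    ; source = source
    ; layer-source = refl
    ; layer-unique = unique
    ; parent = λ v v≢source → let u , u⊲v = above v v≢source in u , inj₁ u⊲v , ⊲-layer u⊲v
    }
    where
    bounded : ∀ v → layer v ≤ suc (suc m)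
    bounded (spine i i≤m) = m≤n⇒m≤1+n (m≤n⇒m≤1+n i≤m)
    bounded hub           = n≤1+n _
    bounded (base _)      = ≤-refl
    bounded (inner _ _)   = n≤1+n _
    bounded (outer _ _)   = ≤-refl
    unique : ∀ v → layer v ≡ 0 → v ≡ source
    unique (spine zero z≤n) refl = refl
    above : ∀ v → v ≢ source → ∃[ u ] (u ⊲ v)
    above (spine zero z≤n) v≢        = contradiction refl v≢
    above (spine (suc i) 1+i≤m) _    = spine i (<⇒≤ 1+i≤m) , spine-spine
    above hub                   _    = spine m ≤-refl , spine-hub
    above (base s)              _    = hub , hub-base
    above (inner c l)           _    = spine m ≤-refl , spine-inner
    above (outer c (k , i , j)) _    = inner c i , inner-outer₁

  reachesDepth : ReachesDepth (suc (suc m)) G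
  reachesDepth = base 0 , refl

  depth : Context → ℕ
  depth root       = 0
  depth (next c _) = suc (depth c)

  W-depth : ∀ c′ {c s x} → W c′ s ≡ outer c x → depth c < depth c′
  W-depth (next c₁ f) {c} {s} eq with f s
  W-depth (next c₁ f) refl | just _  = ≤-refl
  ... | nothing = m<n⇒m<1+n (W-depth c₁ eq)

  -- A node with context `c` joins `W` only at the end of phase `c`, so `c′` extends `c`. Any other
  -- server has then kept its place since `c` began or moved in phase `c` or later.
  W-chain : ∀ c′ {c s x} s′ → W c′ s ≡ outer c x →
            W c′ s′ ≡ W c s′ ⊎ ∃[ c″ ] ∃[ x″ ] W c′ s′ ≡ outer c″ x″ × depth c ≤ depth c″
  W-chain (next c₁ f) {c} {s} s′ eq with f s
  W-chain (next c₁ f) s′ refl | just _ with f s′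
  ... | just x″ = inj₂ (c₁ , x″ , refl , ≤-refl)
  ... | nothing = inj₁ refl
  W-chain (next c₁ f) s′ eq | nothing with f s′
  ... | just x″ = inj₂ (c₁ , x″ , refl , <⇒≤ (W-depth c₁ eq))
  ... | nothing = W-chain c₁ s′ eq

  data Old (c : Context) : Node → Set where
    base  : ∀ {s} → Old c (base s)
    inner : ∀ {c₀ l} → depth c₀ < depth c → Old c (inner c₀ l)
    outer : ∀ {c₀ x} → depth c₀ < depth c → Old c (outer c₀ x)

  old-inner-⋪-outer : ∀ {c c₀ l x} → depth c₀ < depth c → ¬ (inner c₀ l ⊲ outer c x)
  old-inner-⋪-outer lt (inner-W {c₀} _ eq) = <-asym lt (W-depth c₀ (sym eq))
  old-inner-⋪-outer lt inner-outer₁ = <-irrefl refl lt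
  old-inner-⋪-outer lt inner-outer₂ = <-irrefl refl lt

  inner-⋪-outer : ∀ {c l k i j} → l ≢ i → l ≢ j → ¬ (inner c l ⊲ outer c (k , i , j))
  inner-⋪-outer l≢i l≢j (inner-W {c} _ eq) = <-irrefl refl (W-depth c (sym eq))
  inner-⋪-outer l≢i l≢j inner-outer₁ = l≢i refl
  inner-⋪-outer l≢i l≢j inner-outer₂ = l≢j refl

  -- The reason for encoding the history in the nodes: a later common neighbour
  -- of x and an older outer node only exists if that node was still in use when
  -- x was requested.
  old-near-outer : ∀ {c u a x} → Old c u → a ⊲ u → a ⊲ outer c x → ∃[ s ] s < q × u ≡ W c s
  old-near-outer {c} old (inner-W {s = s′} s′<q eq′) (inner-W {c′} _ eq) with W-chain c′ s′ (sym eq)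
  ... | inj₁ eq″ = s′ , s′<q , trans eq′ eq″
  ... | inj₂ (c″ , x″ , eq″ , le) with subst (Old c) (trans eq′ eq″) old
  ...   | outer lt = contradiction le (<⇒≱ lt)
  old-near-outer old (inner-W s<q eq) inner-outer₁ = _ , s<q , eq
  old-near-outer old (inner-W s<q eq) inner-outer₂ = _ , s<q , eq
  old-near-outer (outer lt) inner-outer₁ (inner-W {c′} _ eq) = contradiction (W-depth c′ (sym eq)) (<-asym lt)
  old-near-outer (outer lt) inner-outer₂ (inner-W {c′} _ eq) = contradiction (W-depth c′ (sym eq)) (<-asym lt)
  old-near-outer (outer lt) inner-outer₁ inner-outer₁ = contradiction refl (<⇒≢ lt)
  old-near-outer (outer lt) inner-outer₂ inner-outer₁ = contradiction refl (<⇒≢ lt)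
  old-near-outer (outer lt) inner-outer₁ inner-outer₂ = contradiction refl (<⇒≢ lt)
  old-near-outer (outer lt) inner-outer₂ inner-outer₂ = contradiction refl (<⇒≢ lt)

  old-near-inner : ∀ {c l v} → Old c v → inner c l ⊲ v → ∃[ s ] s < q × v ≡ W c s
  old-near-inner old (inner-W s<q eq) = _ , s<q , eq
  old-near-inner (outer lt) inner-outer₁ = contradiction refl (<⇒≢ lt)
  old-near-inner (outer lt) inner-outer₂ = contradiction refl (<⇒≢ lt)

-- β and δ are the amortised prices of moving a server to an outer and to an
-- inner node; only a move to an inner node from an adjacent outer one may be
-- cheaper (γ), and then the outer node can be requested again. Every server on
-- an inner node carries the potential θ.
record Prices (m : ℕ) : Set where
  field
    β γ δ θ       : ℕ
    source-outer  : β + δ ≤ 2 + m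
    source-inner  : δ + θ ≤ 1 + m
    inner-outer   : β ≤ θ + 1
    inner≁outer   : β + δ ≤ θ + 3
    inner-inner   : δ ≤ 2
    outer-outer   : β ≤ 2
    outer-inner   : γ + θ ≤ 1
    outer≁inner   : δ + θ ≤ 3
    detour        : δ ≤ γ + β

-- Distinct numbers outside a finite list.

missing-element : ∀ Q (F : List ℕ) → length F < Q → ∃[ s ] s < Q × s ∉ F
missing-element (suc Q) F le with Q ∈? F
... | no Q∉F  = Q , ≤-refl , Q∉F
... | yes Q∈F with ∈-∃++ Q∈F
...   | as , bs , refl with missing-element Q (as ++ bs) (≤-pred (subst (_≤ suc Q) (cong suc length≡) le))
  where
  length≡ : length (as ++ Q ∷ bs) ≡ suc (length (as ++ bs))
  length≡ = ↭-length (shift Q as bs)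
...     | s , s<Q , s∉ = s , m<n⇒m<1+n s<Q , λ s∈ → not-in (∈-++⁻ as s∈)
  where
  not-in : s ∈ as ⊎ s ∈ Q ∷ bs → ⊥
  not-in (inj₁ s∈as)         = s∉ (∈-++⁺ˡ s∈as)
  not-in (inj₂ (here refl))  = <-irrefl refl s<Q
  not-in (inj₂ (there s∈bs)) = s∉ (∈-++⁺ʳ as s∈bs)

-- Each chosen number joins the forbidden list, which makes the choice injective.
missing-elements : ∀ N Q (F : List ℕ) → length F + N ≤ Q → Σ[ e ∈ (ℕ → ℕ) ] (∀ {l} → l < N → e l < Q) ×
  (∀ {l} → l < N → e l ∉ F) × (∀ {l l′} → l < N → l′ < N → e l ≡ e l′ → l ≡ l′)
missing-elements zero    Q F le = (λ l → l) , (λ ()) , (λ ()) , λ ()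
missing-elements (suc N) Q F le
  with missing-element Q F (≤-trans (s≤s (m≤m+n (length F) N)) (≤-trans (≤-reflexive (sym (+-suc (length F) N))) le))
... | s , s<Q , s∉F with missing-elements N Q (s ∷ F) (≤-trans (≤-reflexive (sym (+-suc (length F) N))) le)
...   | e , in-range , avoids , injective = e′ , in-range′ , avoids′ , injective′
  where
  e′ : ℕ → ℕ
  e′ zero    = s
  e′ (suc l) = e l
  in-range′ : ∀ {l} → l < suc N → e′ l < Q
  in-range′ {zero}  _         = s<Q
  in-range′ {suc l} (s≤s l<N) = in-range l<N
  avoids′ : ∀ {l} → l < suc N → e′ l ∉ F
  avoids′ {zero}  _         = s∉F
  avoids′ {suc l} (s≤s l<N) = λ e∈ → avoids l<N (there e∈)
  injective′ : ∀ {l l′} → l < suc N → l′ < suc N → e′ l ≡ e′ l′ → l ≡ l′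
  injective′ {zero}  {zero}   _         _          eq = refl
  injective′ {zero}  {suc l′} _         (s≤s l′<N) eq = contradiction (here (sym eq)) (avoids l′<N)
  injective′ {suc l} {zero}   (s≤s l<N) _          eq = contradiction (here eq) (avoids l<N)
  injective′ {suc l} {suc l′} (s≤s l<N) (s≤s l′<N) eq = cong suc (injective l<N l′<N eq)

-- The game: amortised prices of single moves.

module Game (em : ExcludedMiddle 0ℓ) (m n : ℕ) (prices : Prices m) where
  open Prices prices

  -- In one phase, `n` inner and `n - 1` outer requests forbid at most one server each, so at least
  -- `n` of the servers on `W` remain to be picked.
  q : ℕ
  q = n + n + n

  open Arena m q hiding (layer; source)
  open LayeredGraph G using (layer; source; _~_; Walk; []; _∷_)
  open InfiniteServer em G
  open Servers em G

  φ : Node → ℕ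
  φ (inner _ _) = θ
  φ _           = 0

  IsOuter : Node → Set
  IsOuter v = layer v ≡ suc (suc m)

  φ-outer : ∀ {v} → IsOuter v → φ v ≡ 0
  φ-outer {spine _ _} _ = refl
  φ-outer {hub}       _ = refl
  φ-outer {base _}    _ = refl
  φ-outer {inner _ _} ()
  φ-outer {outer _ _} _ = refl

  data Kind : Node → Set where
    origin : Kind source
    inner  : ∀ {c l} → Kind (inner c l)
    outer  : ∀ {v} → IsOuter v → Kind v

  outer≢source : ∀ {v} → IsOuter v → v ≢ source
  outer≢source () refl

  inner-~⇒⊲ : ∀ {c l v} → IsOuter v → inner c l ~ v → inner c l ⊲ v
  inner-~⇒⊲ v-outer (inj₁ e) = e
  inner-~⇒⊲ v-outer (inj₂ e) = contradiction (trans (cong suc (sym v-outer)) (sym (⊲-layer e))) λ ()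

  -- An adjacent outer node is the only cheap place to come from; that case is left to
  -- `price-near-inner`.
  price-inner : ∀ {u c l} → Kind u → u ≢ inner c l → ¬ (inner c l ⊲ u) →
                δ + θ ≤ φ u + dist u (inner c l)
  price-inner origin u≢ _ = ≤-trans source-inner (layer≤dist _)
  price-inner inner  u≢ _ = ≤-trans (≤-reflexive (+-comm δ θ))
    (+-monoʳ-≤ θ (≤-trans inner-inner (same-layer⇒2≤dist refl u≢)))
  price-inner {u} {c} {l} (outer o) u≢ ⋪ = ≤-trans outer≁inner
    (≤-trans (other-layer-≁⇒3≤dist (inj₁ o) (λ e → ⋪ (inner-~⇒⊲ o (LayeredGraph.~-sym G {u} {inner c l} e)))) (m≤n+m _ (φ u)))

  price-near-inner : ∀ {u c l} → u ≢ inner c l → γ + θ ≤ φ u + dist u (inner c l)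
  price-near-inner {u} u≢ = ≤-trans outer-inner (≤-trans (≢⇒1≤dist u≢) (m≤n+m _ (φ u)))

  price-outer : ∀ {u v} → Kind u → IsOuter v → u ≢ v → β + φ v ≤ φ u + dist u v
  price-outer {u} {v} kind o u≢v =
    ≤-trans (≤-reflexive (trans (cong (λ k → β + k) (φ-outer {v} o)) (+-identityʳ β))) (by kind)
    where
    by : Kind u → β ≤ φ u + dist u v
    by origin = ≤-trans (≤-trans (m≤m+n β δ) source-outer) (≤-trans (≤-reflexive (sym o)) (layer≤dist v))
    by inner  = ≤-trans inner-outer (+-monoʳ-≤ θ (≢⇒1≤dist u≢v))
    by (outer o′) = ≤-trans outer-outer (≤-trans (same-layer⇒2≤dist (trans o′ (sym o)) u≢v) (m≤n+m _ (φ u)))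

  price-near-outer : ∀ {u c x} → IsOuter u → u ≢ outer c x → δ + 0 ≤ φ u + dist u (outer c x)
  price-near-outer {u} o u≢ = ≤-trans (≤-reflexive (+-identityʳ δ))
    (≤-trans inner-inner (≤-trans (same-layer⇒2≤dist o u≢) (m≤n+m _ (φ u))))

  -- Without an edge or a common neighbour, parity raises the distance to 3 from an inner node and
  -- to 4 from an outer one. The trailing 0 is the potential of the target.
  price-far-outer : ∀ {u c x} → Kind u → u ≢ outer c x → ¬ (u ⊲ outer c x) →
                    (∀ a → a ⊲ u → ¬ (a ⊲ outer c x)) → β + δ + 0 ≤ φ u + dist u (outer c x)
  price-far-outer {u} {c} {x} kind u≢ ⋪ far =
    ≤-trans (≤-reflexive (+-identityʳ (β + δ))) (by kind)
    where
    ⊲-outer : ∀ {w v} → IsOuter v → w ~ v → w ⊲ v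
    ⊲-outer o (inj₁ e) = e
    ⊲-outer {w} o (inj₂ e) = contradiction (LayeredGraph.layer≤D G w)
      (<⇒≱ (≤-reflexive (trans (cong suc (sym o)) (sym (⊲-layer e)))))
    by : Kind u → β + δ ≤ φ u + dist u (outer c x)
    by origin = ≤-trans source-outer (layer≤dist _)
    by inner  = ≤-trans inner≁outer (+-monoʳ-≤ θ (other-layer-≁⇒3≤dist (inj₂ refl) (λ e → ⋪ (⊲-outer refl e))))
    by (outer o) = ≤-trans (+-mono-≤ outer-outer inner-inner) (≤-trans
      (same-layer-≁²⇒4≤dist {u} {outer c x} o u≢
        (λ w e f → far w (⊲-outer o (LayeredGraph.~-sym G {u} {w} e)) (⊲-outer refl f))) (m≤n+m _ (φ u)))

  -- Offline schedules whose moving servers are still undecided.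

  -- The `l`-th picked server waits on its inner node as long as `g l` is `nothing`.
  pos : Context → (ℕ → Maybe Label) → ℕ → Node
  pos c g l = maybe (outer c) (inner c l) (g l)

  _[_≔_] : (ℕ → Maybe Label) → ℕ → Label → ℕ → Maybe Label
  (g [ l ≔ x ]) t with t ≟ l
  ... | yes _ = just x
  ... | no _  = g t

  set-same : ∀ g l x → (g [ l ≔ x ]) l ≡ just x
  set-same g l x with l ≟ l
  ... | yes _  = refl
  ... | no l≢l = contradiction refl l≢l

  set-other : ∀ g l x {t} → t ≢ l → (g [ l ≔ x ]) t ≡ g t
  set-other g l x {t} t≢l with t ≟ l
  ... | yes t≡l = contradiction t≡l t≢l
  ... | no _    = refl

  record Picks (e : ℕ → ℕ) (F : List ℕ) : Set where
    field
      in-range  : ∀ {l} → l < n → e l < q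
      avoids    : ∀ {l} → l < n → e l ∉ F
      injective : ∀ {l l′} → l < n → l′ < n → e l ≡ e l′ → l ≡ l′

  open Picks

  picks-tail : ∀ {e s F} → Picks e (s ∷ F) → Picks e F
  picks-tail P = record { in-range = in-range P ; avoids = λ l<n e∈ → avoids P l<n (there e∈) ; injective = injective P }

  -- An offline schedule in which server s starts at W c s and the l-th picked
  -- server e l has moved on to pos c g l for l < k.
  record Schedule (c : Context) (g : ℕ → Maybe Label) (k : ℕ) (e : ℕ → ℕ) (σ : Requests) (cost : ℕ) : Set where
    field
      config  : Config
      spent   : ℕ
      spent≤  : spent ≤ cost
      service : Service σ config spent
      picked  : ∀ {l} → l < k → config (e l) ≡ pos c g l
      rest    : ∀ {s} → s < q → (∀ {l} → l < k → s ≢ e l) → config s ≡ W c s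

  open Schedule

  -- Which servers leave W is left open: the picks need only avoid the servers
  -- in F, whose nodes were requested again.
  Feasible : Context → (ℕ → Maybe Label) → ℕ → List ℕ → Requests → ℕ → Set
  Feasible c g k F σ cost = ∀ {e} → Picks e F → Schedule c g k e σ cost

  schedule-stay : ∀ {c g k e σ cost r} (S : Schedule c g k e σ cost) → Occupied (config S) r →
                  Schedule c g k e (r ∷ σ) cost
  schedule-stay {r = r} S occ = record
    { config = config S ; spent = spent S + 0
    ; spent≤ = ≤-trans (≤-reflexive (+-identityʳ _)) (spent≤ S)
    ; service = serve (service S) r [] occ ; picked = picked S ; rest = rest S }

  -- The request is free if server `s` has not left `W`; this is ensured by forbidding it as a pick.
  feasible-W : ∀ {c g k F σ cost s} → k ≤ n → s < q → Feasible c g k F σ cost →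
               Feasible c g k (s ∷ F) (W c s ∷ σ) cost
  feasible-W {s = s} k≤n s<q feas P = schedule-stay S
    (s , rest S s<q (λ l<k s≡ → avoids P (<-≤-trans l<k k≤n) (here (sym s≡))))
    where S = feas (picks-tail P)

  feasible-pos : ∀ {c g k F σ cost l} → l < k → Feasible c g k F σ cost →
                 Feasible c g k F (pos c g l ∷ σ) cost
  feasible-pos {l = l} l<k feas {e} P = schedule-stay S (e l , picked S l<k)
    where S = feas P

  -- Covers both kinds of offline move: from `W` to an inner node, where `l` is the new index, and
  -- from an inner to an outer node, where the number of picked servers is unchanged.
  schedule-advance : ∀ {c g g′ k k′ e F σ cost l} v → Picks e F → k′ ≤ n → l < k′ → k ≤ k′ →
    (∀ {t} → t < k′ → t ≢ l → t < k × pos c g′ t ≡ pos c g t) → pos c g′ l ≡ v →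
    (S : Schedule c g k e σ cost) → config S (e l) ~ v → Schedule c g′ k′ e (v ∷ σ) (suc cost)
  schedule-advance {c} {g} {g′} {k} {k′} {e} {σ = σ} {cost} {l} v P k′≤n l<k′ k≤k′ others here≡ S adj = record
    { config = config S [ e l ↦ v ]
    ; spent = spent S + (dist (config S (e l)) v + 0)
    ; spent≤ = ≤-trans (+-mono-≤ (spent≤ S) (≤-trans (≤-reflexive (+-identityʳ _)) (dist-≤ (adj ∷ []))))
                       (≤-reflexive (+-comm cost 1))
    ; service = serve (service S) v ((e l , v) ∷ []) (e l , moved (config S) (e l) v)
    ; picked = picked′
    ; rest = λ s<q not-e → trans (unmoved (config S) (e l) v (not-e l<k′))
               (rest S s<q (λ t<k → not-e (<-≤-trans t<k k≤k′)))
    }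
    where
    picked′ : ∀ {t} → t < k′ → (config S [ e l ↦ v ]) (e t) ≡ pos c g′ t
    picked′ {t} t<k′ with t ≟ l
    ... | yes refl = trans (moved (config S) (e l) v) (sym here≡)
    ... | no t≢l   = let t<k , eq = others t<k′ t≢l in
      trans (unmoved (config S) (e l) v (λ et≡el → t≢l (injective P (<-≤-trans t<k′ k′≤n) (<-≤-trans l<k′ k′≤n) et≡el)))
            (trans (picked S t<k) (sym eq))

  feasible-inner : ∀ {c g k F σ cost} → k < n → g k ≡ nothing → Feasible c g k F σ cost →
                   Feasible c g (suc k) F (inner c k ∷ σ) (suc cost)
  feasible-inner {c} {g} {k} k<n gk feas {e} P = schedule-advance (inner c k) P k<n ≤-refl (n≤1+n k)
    (λ t<1+k t≢k → ≤∧≢⇒< (≤-pred t<1+k) t≢k , refl)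
    (cong (maybe (outer c) (inner c k)) gk) S
    (subst (_~ inner c k) (sym at-W) (inj₂ (inner-W (in-range P k<n) refl)))
    where
    S = feas P
    at-W : config S (e k) ≡ W c (e k)
    at-W = rest S (in-range P k<n) (λ l<k ek≡el → <⇒≢ l<k (sym (injective P k<n (<-trans l<k k<n) ek≡el)))

  feasible-outer : ∀ {c g l x F σ cost} → l < n → g l ≡ nothing → inner c l ⊲ outer c x → Feasible c g n F σ cost →
                   Feasible c (g [ l ≔ x ]) n F (outer c x ∷ σ) (suc cost)
  feasible-outer {c} {g} {l} {x} l<n gl adj feas {e} P = schedule-advance (outer c x) P ≤-refl l<n ≤-refl
    (λ {t} t<n t≢l → t<n , cong (maybe (outer c) (inner c t)) (set-other g l x t≢l))
    (cong (maybe (outer c) (inner c l)) (set-same g l x)) S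
    (subst (_~ outer c x) (sym (trans (picked S l<n) (cong (maybe (outer c) (inner c l)) gl))) (inj₁ adj))
    where S = feas P

  data Placed (c : Context) (g : ℕ → Maybe Label) (k : ℕ) : Node → Set where
    origin : Placed c g k source
    old    : ∀ {u} → Old c u → Placed c g k u
    inner  : ∀ {l} → l < k → Placed c g k (inner c l)
    outer  : ∀ {l x} → l < k → g l ≡ just x → Placed c g k (outer c x)

  kind : ∀ {c g k u} → Placed c g k u → Kind u
  kind origin          = origin
  kind (old base)      = outer refl
  kind (old (inner _)) = inner
  kind (old (outer _)) = outer refl
  kind (inner _)       = inner
  kind (outer _ _)     = outer refl

  placed-set : ∀ {c g k u l x} → g l ≡ nothing → Placed c g k u → Placed c (g [ l ≔ x ]) k u
  placed-set gl origin      = origin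
  placed-set gl (old o)     = old o
  placed-set gl (inner l<k) = inner l<k
  placed-set {g = g} {l = l} {x} gl (outer {l = t} t<k gt) = outer t<k (trans (set-other g l x t≢l) gt)
    where
    t≢l : t ≢ l
    t≢l refl with trans (sym gl) gt
    ... | ()

  placed-suc : ∀ {c g k u} → Placed c g k u → Placed c g (suc k) u
  placed-suc origin         = origin
  placed-suc (old o)        = old o
  placed-suc (inner l<k)    = inner (m<n⇒m<1+n l<k)
  placed-suc (outer l<k gl) = outer (m<n⇒m<1+n l<k) gl

  -- The lazy shadow of an online algorithm.

  module Against (A : OnlineAlgorithm) where

    -- The cost of the algorithm covers the guaranteed amount `acc`, the potential of the shadow
    -- `L`, and the lag of `L` behind the real servers.
    Track : Requests → Config → ℕ → Set
    Track σ L acc = Within (λ t → φ (L t) + dist (L t) (configAfter (OnlineAlgorithm.respond A) σ t)) acc (ALG A σ)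

    -- Makes a node other than the source vacant once a server leaves it, see `vacated`.
    Separate : Config → Set
    Separate L = ∀ {s t} → L s ≡ L t → L s ≢ source → s ≡ t

    -- By the triangle inequality the lag grows by at most the distance travelled.
    track-execute : ∀ {L : Config} {C x y} ms → Within (λ t → φ (L t) + dist (L t) (C t)) x y →
                    Within (λ t → φ (L t) + dist (L t) (execute C ms t)) x (y + travel C ms)
    track-execute {L} {C} {x} {y} [] wi = subst (Within _ x) (sym (+-identityʳ y)) wi
    track-execute {L} {C} {x} {y} ((s , v) ∷ ms) wi = subst (Within _ x) (+-assoc y _ _)
      (track-execute {L} {C [ s ↦ v ]} ms (subst (λ z → Within _ z _) (+-identityʳ x)
        (within-update wi (λ t t≢s → cong (λ w → φ (L t) + dist (L t) w) (unmoved C s v t≢s)) le)))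
      where
      open ≤-Reasoning
      le : φ (L s) + dist (L s) ((C [ s ↦ v ]) s) + 0 ≤ φ (L s) + dist (L s) (C s) + dist (C s) v
      le = begin
        φ (L s) + dist (L s) ((C [ s ↦ v ]) s) + 0      ≡⟨ +-identityʳ _ ⟩
        φ (L s) + dist (L s) ((C [ s ↦ v ]) s)          ≡⟨ cong (λ w → φ (L s) + dist (L s) w) (moved C s v) ⟩
        φ (L s) + dist (L s) v                          ≤⟨ +-monoʳ-≤ (φ (L s)) (dist-triangle _ (C s) v) ⟩
        φ (L s) + (dist (L s) (C s) + dist (C s) v)     ≡⟨ +-assoc (φ (L s)) _ _ ⟨
        φ (L s) + dist (L s) (C s) + dist (C s) v       ∎

    -- The lazy shadow of the algorithm moves only the server that the algorithm
    -- uses for the request, and only if the request is vacant; its lag behind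
    -- the algorithm is paid for by the distance term in Track.
    record Served (σ : Requests) (L : Config) (r : Node) : Set where
      field
        server   : ℕ
        elsewhere : L server ≢ r
        separate : Separate (L [ server ↦ r ])
        track    : ∀ {b acc} → Track σ L acc → b + φ r ≤ φ (L server) + dist (L server) r →
                   Track (r ∷ σ) (L [ server ↦ r ]) (acc + b)

    open Served

    -- Once the server `s` of the algorithm stands on `r`, its lag is `dist (L s) r`. Letting the
    -- shadow follow releases this amount, which pays for `b`.
    serve-lazily : ∀ {σ L r} → Separate L → ¬ Occupied L r → r ≢ source → Served σ L r
    serve-lazily {σ} {L} {r} sep vacant r≢source = record
      { server = s ; elsewhere = λ eq → vacant (s , eq) ; separate = separate′ ; track = track′ }
      where
      open OnlineAlgorithm A using (respond; serves)
      s = proj₁ (serves σ r)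
      C′ = configAfter respond (r ∷ σ)
      separate′ : Separate (L [ s ↦ r ])
      separate′ {a} {b} eq a≢ with a ≟ s | b ≟ s
      ... | yes refl | yes refl = refl
      ... | yes refl | no b≢s   = contradiction (b , trans (sym (unmoved L s r b≢s)) (trans (sym eq) (moved L s r))) vacant
      ... | no a≢s   | yes refl = contradiction (a , trans (sym (unmoved L s r a≢s)) (trans eq (moved L s r))) vacant
      ... | no a≢s   | no b≢s   = sep (trans (sym (unmoved L s r a≢s)) (trans eq (unmoved L s r b≢s)))
                                      (λ eq′ → a≢ (trans (unmoved L s r a≢s) eq′))
      track′ : ∀ {b acc} → Track σ L acc → b + φ r ≤ φ (L s) + dist (L s) r → Track (r ∷ σ) (L [ s ↦ r ]) (acc + b)
      track′ {b} {acc} tr price = subst (Within _ (acc + b)) (+-identityʳ _)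
        (within-update (track-execute {L} {configAfter respond σ} (respond σ r) tr)
          (λ t t≢s → cong (λ w → φ w + dist w (C′ t)) (unmoved L s r t≢s)) le)
        where
        open ≤-Reasoning
        le : φ ((L [ s ↦ r ]) s) + dist ((L [ s ↦ r ]) s) (C′ s) + b ≤ φ (L s) + dist (L s) (C′ s) + 0
        le = begin
          φ ((L [ s ↦ r ]) s) + dist ((L [ s ↦ r ]) s) (C′ s) + b ≡⟨ cong₂ (λ v w → φ v + dist v w + b) (moved L s r) (proj₂ (serves σ r)) ⟩
          φ r + dist r r + b                                      ≡⟨ cong (λ z → φ r + z + b) (dist-self r) ⟩
          φ r + 0 + b                                             ≡⟨ cong (_+ b) (+-identityʳ (φ r)) ⟩
          φ r + b                                                 ≡⟨ +-comm (φ r) b ⟩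
          b + φ r                                                 ≤⟨ price ⟩
          φ (L s) + dist (L s) r                                  ≡⟨ cong (λ w → φ (L s) + dist (L s) w) (proj₂ (serves σ r)) ⟨
          φ (L s) + dist (L s) (C′ s)                             ≡⟨ +-identityʳ _ ⟨
          φ (L s) + dist (L s) (C′ s) + 0                         ∎

    vacated : ∀ {L s r} → Separate L → L s ≢ source → L s ≢ r → ¬ Occupied (L [ s ↦ r ]) (L s)
    vacated {L} {s} {r} sep Ls≢source Ls≢r (t , eq) with t ≟ s
    ... | yes refl = Ls≢r (trans (sym eq) (moved L s r))
    ... | no t≢s   = t≢s (sym (sep (sym (trans (sym (unmoved L s r t≢s)) eq)) Ls≢source))

    update-all : ∀ (P : Node → Set) L s r → (∀ t → P (L t)) → P r → ∀ t → P ((L [ s ↦ r ]) t)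
    update-all P L s r all Pr t with s ≟ t
    ... | yes _ = Pr
    ... | no _  = all t

    -- Invariants within a phase and the answers to single requests.

    -- `acc` is guaranteed as online cost, `cost` bounds the offline cost for every choice of picks,
    -- and `fixed` bounds the number of forbidden picks.
    record State (c : Context) (g : ℕ → Maybe Label) (k acc cost fixed : ℕ) : Set where
      constructor state
      field
        {σ}      : Requests
        {L}      : Config
        {F}      : List ℕ
        track    : Track σ L acc
        separate : Separate L
        placed   : ∀ t → Placed c g k (L t)
        feasible : Feasible c g k F σ cost
        length≤  : length F ≤ fixed

    -- The schedules already serve `r`, while the shadow has yet to answer it.
    record Pending (c : Context) (g : ℕ → Maybe Label) (k : ℕ) (r : Node) (acc cost fixed : ℕ) : Set where
      constructor pending
      field
        {σ}      : Requests
        {L}      : Config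
        {F}      : List ℕ
        track    : Track σ L acc
        separate : Separate L
        placed   : ∀ t → Placed c g k (L t)
        vacant   : ¬ Occupied L r
        feasible : Feasible c g k F (r ∷ σ) cost
        length≤  : length F ≤ fixed

    weaken : ∀ {c g k acc acc′ cost fixed fixed′} → acc′ ≤ acc → fixed ≤ fixed′ →
             State c g k acc cost fixed → State c g k acc′ cost fixed′
    weaken acc≤ fixed≤ (state tr sep pl fe le) = state (within-weaken acc≤ tr) sep pl fe (≤-trans le fixed≤)

    answer-outer : ∀ {c g k r acc cost fixed} → IsOuter r → Placed c g k r →
                   Pending c g k r acc cost fixed → State c g k (acc + β) cost fixed
    answer-outer {c} {g} {k} {r} o at (pending {L = L} tr sep pl vac fe le) =
      state (track S tr (price-outer (kind (pl (server S))) o (elsewhere S))) (separate S)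
            (update-all (Placed c g k) L (server S) r pl at) fe le
      where S = serve-lazily sep vac (outer≢source o)

    again-W : ∀ {c g k σ L F acc cost fixed s} → k ≤ n → s < q → Track σ L acc → Separate L →
              (∀ t → Placed c g k (L t)) → ¬ Occupied L (W c s) → Placed c g k (W c s) →
              Feasible c g k F σ cost → length F ≤ fixed → State c g k (acc + β) cost (suc fixed)
    again-W {c} {s = s} k≤n s<q tr sep pl vac at fe le =
      answer-outer (layer-W c s) at (pending tr sep pl vac (feasible-W k≤n s<q fe) (s≤s le))

    -- A picked server stands on this node in every schedule, so no pick is forbidden; the bound is
    -- relaxed only to agree with `again-W`.
    again-outer : ∀ {c g k σ L F acc cost fixed l x} → l < k → g l ≡ just x → Track σ L acc → Separate L →
                  (∀ t → Placed c g k (L t)) → ¬ Occupied L (outer c x) →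
                  Feasible c g k F σ cost → length F ≤ fixed → State c g k (acc + β) cost (suc fixed)
    again-outer {c} {g} {l = l} {x} l<k gl tr sep pl vac fe le = weaken ≤-refl (n≤1+n _)
      (answer-outer refl (outer l<k gl) (pending tr sep pl vac
        (subst (λ v → Feasible _ g _ _ (v ∷ _) _) (cong (maybe (outer c) (inner c l)) gl) (feasible-pos l<k fe)) le))

    -- A server from an adjacent outer node pays only `γ`, but that node belongs to `W` or to the
    -- current phase, so it can be requested again for `β`, and `detour` applies. From anywhere else
    -- the price is `δ`.
    answer-inner : ∀ {c g k t acc cost fixed} → k ≤ n → t < k →
                   Pending c g k (inner c t) acc cost fixed → State c g k (acc + δ) cost (suc fixed)
    answer-inner {c} {g} {k} {t} {acc} {cost} {fixed} k≤n t<k (pending {σ} {L} {F} tr sep pl vac fe le) with em {inner c t ⊲ L s}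
      where
      s = server (serve-lazily {σ} sep vac λ ())
    ... | no ⋪ = weaken ≤-refl (n≤1+n _)
      (state (track S tr (price-inner (kind (pl (server S))) (elsewhere S) ⋪)) (separate S) pl′ fe le)
      where
      S = serve-lazily {σ} sep vac λ ()
      pl′ = update-all (Placed c g k) L (server S) (inner c t) pl (inner t<k)
    ... | yes adj = weaken (≤-trans (+-monoʳ-≤ acc detour) (≤-reflexive (sym (+-assoc acc γ β)))) ≤-refl
                           (by (L (server S)) refl (pl (server S)))
      where
      S = serve-lazily {σ} sep vac λ ()
      tr′ = track S tr (price-near-inner (elsewhere S))
      pl′ = update-all (Placed c g k) L (server S) (inner c t) pl (inner t<k)
      vac′ : L (server S) ≢ source → ¬ Occupied (L [ server S ↦ inner c t ]) (L (server S))
      vac′ ≢source = vacated sep ≢source (elsewhere S)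
      outer-adj : IsOuter (L (server S))
      outer-adj = ⊲-layer adj
      by : ∀ v → L (server S) ≡ v → Placed c g k v → State c g k (acc + γ + β) cost (suc fixed)
      by v eq (old o) with old-near-inner o (subst (inner c t ⊲_) eq adj)
      ... | s , s<q , v≡W = again-W k≤n s<q tr′ (separate S) pl′
              (subst (λ w → ¬ Occupied (L [ server S ↦ inner c t ]) w) (trans eq v≡W) (vac′ (outer≢source outer-adj)))
              (subst (Placed c g k) v≡W (old o)) fe le
      by v eq (outer l<k gl) = again-outer l<k gl tr′ (separate S) pl′
              (subst (λ w → ¬ Occupied (L [ server S ↦ inner c t ]) w) eq (vac′ (outer≢source outer-adj))) fe le
      by v eq origin with trans (sym outer-adj) (cong layer eq)
      ... | ()
      by v eq (inner l<k) = contradiction (trans (sym outer-adj) (cong layer eq)) 1+n≢n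

    placed-inner-< : ∀ {c g k l} → Placed c g k (inner c l) → l < k
    placed-inner-< (old (inner lt)) = contradiction refl (<⇒≢ lt)
    placed-inner-< (inner l<k)      = l<k

    -- Inner requests and the tournament of outer requests.

    all-inner : ℕ → Maybe Label
    all-inner _ = nothing

    inner-step : ∀ {c k acc cost fixed} → k < n → State c all-inner k acc cost fixed →
                 State c all-inner (suc k) (acc + δ) (suc cost) (suc fixed)
    inner-step {c} {k} k<n (state tr sep pl fe le) = answer-inner k<n ≤-refl
      (pending tr sep (λ t → placed-suc (pl t))
        (λ { (t , eq) → <-irrefl refl (placed-inner-< {g = all-inner} (subst (Placed c all-inner k) eq (pl t))) })
        (feasible-inner k<n refl fe) le)

    -- A tournament among the inner nodes of a phase: after k rounds, j is the
    -- winner among 0, …, k, and the servers of the losers have moved on.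
    record Round (g : ℕ → Maybe Label) (j k : ℕ) : Set where
      field
        j≤k     : j ≤ k
        winner  : g j ≡ nothing
        waiting : ∀ {l} → k < l → g l ≡ nothing
        losers  : ∀ {l} → l ≤ k → l ≢ j → ∃[ x ] g l ≡ just x × proj₁ x < k

    open Round

    -- The reigning winner `j` meets the newcomer `suc k`; the indices are the loser and then the
    -- winner.
    data Match (j k : ℕ) : ℕ → ℕ → Set where
      first-loses  : Match j k j (suc k)
      second-loses : Match j k (suc k) j

    module _ {g j k} (R : Round g j k) where

      -- Old nodes have smaller depth, and labels given earlier in this phase have a smaller round.
      outer-vacant : ∀ {c i i′} → ¬ Placed c g n (outer c (k , i , i′))
      outer-vacant (old (outer lt)) = <-irrefl refl lt
      outer-vacant (outer {l} _ gl) with l ≤? k | l ≟ j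
      ... | no l≰k  | _ with trans (sym (waiting R (≰⇒> l≰k))) gl
      ...   | ()
      outer-vacant (outer {l} _ gl) | yes l≤k | yes refl with trans (sym (winner R)) gl
      ... | ()
      outer-vacant (outer {l} _ gl) | yes l≤k | no l≢j with losers R l≤k l≢j
      ... | x , gl′ , x<k with trans (sym gl) gl′
      ...   | refl = <-irrefl refl x<k

      j≢1+k : j ≢ suc k
      j≢1+k = <⇒≢ (s≤s (j≤k R))

      loser≢winner : ∀ {l w} → Match j k l w → l ≢ w
      loser≢winner first-loses  = j≢1+k
      loser≢winner second-loses = ≢-sym j≢1+k

      match-alive : ∀ {l w} → Match j k l w → g l ≡ nothing × g w ≡ nothing
      match-alive first-loses  = winner R , waiting R ≤-refl
      match-alive second-loses = waiting R ≤-refl , winner R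

      match-< : ∀ {l w} → suc k < n → Match j k l w → l < n × w < n
      match-< 1+k<n first-loses  = <-trans (s≤s (j≤k R)) 1+k<n , 1+k<n
      match-< 1+k<n second-loses = 1+k<n , <-trans (s≤s (j≤k R)) 1+k<n

      match-⊲ : ∀ {c l w} → Match j k l w → inner c l ⊲ outer c (k , j , suc k) × inner c w ⊲ outer c (k , j , suc k)
      match-⊲ first-loses  = inner-outer₁ , inner-outer₂
      match-⊲ second-loses = inner-outer₂ , inner-outer₁

      next-round : ∀ {l w i i′} → Match j k l w → Round (g [ l ≔ k , i , i′ ]) w (suc k)
      next-round {l} {w} match = record
        { j≤k     = w≤1+k match
        ; winner  = trans (set-other g l _ (≢-sym (loser≢winner match))) (proj₂ (match-alive match))
        ; waiting = λ 1+k<t → trans (set-other g l _ (≢-sym (<⇒≢ (≤-<-trans (l≤1+k match) 1+k<t)))) (waiting R (<⇒≤ 1+k<t))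
        ; losers  = losers′ match
        }
        where
        w≤1+k : ∀ {l w} → Match j k l w → w ≤ suc k
        w≤1+k first-loses  = ≤-refl
        w≤1+k second-loses = m≤n⇒m≤1+n (j≤k R)
        l≤1+k : ∀ {l w} → Match j k l w → l ≤ suc k
        l≤1+k first-loses  = m≤n⇒m≤1+n (j≤k R)
        l≤1+k second-loses = ≤-refl
        earlier : ∀ {t} → t ≤ suc k → t ≢ j → t ≢ suc k → ∃[ x ] g t ≡ just x × proj₁ x < suc k
        earlier t≤ t≢j t≢1+k with losers R (≤-pred (≤∧≢⇒< t≤ t≢1+k)) t≢j
        ... | x , eq , lt = x , eq , m<n⇒m<1+n lt
        losers′ : ∀ {l w i i′} → Match j k l w → ∀ {t} → t ≤ suc k → t ≢ w →
                  ∃[ x ] (g [ l ≔ k , i , i′ ]) t ≡ just x × proj₁ x < suc k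
        losers′ {l} match {t} t≤ t≢w with t ≟ l
        losers′ match        t≤ t≢w | yes refl = _ , refl , ≤-refl
        losers′ first-loses  t≤ t≢w | no t≢l   = earlier t≤ t≢l t≢w
        losers′ second-loses t≤ t≢w | no t≢l   = earlier t≤ t≢w t≢l

    -- The origin of the answering server decides. From far away it pays `β + δ` at once. From a
    -- contender it pays `β`, and `δ` when that inner node is requested again. From an outer node
    -- held offline it pays `δ`, and `β` when that node is requested again.
    outer-step : ∀ {c g j k acc cost fixed} → suc k < n → Round g j k → State c g n acc cost fixed →
                 ∃[ g′ ] ∃[ j′ ] Round g′ j′ (suc k) × State c g′ n (acc + (β + δ)) (suc cost) (suc fixed)
    outer-step {c} {g} {j} {k} {acc} {cost} {fixed} 1+k<n R (state {σ} {L} {F} tr sep pl fe le) = by _ refl (pl s)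
      where
      x = k , j , suc k
      S = serve-lazily {σ} {L} {outer c x} sep (λ { (t , eq) → outer-vacant R (subst (Placed c g n) eq (pl t)) }) λ ()
      s = server S
      L′ = L [ s ↦ outer c x ]

      feasible′ : ∀ {l w} → Match j k l w → Feasible c (g [ l ≔ x ]) n F (outer c x ∷ σ) (suc cost)
      feasible′ match = feasible-outer (proj₁ (match-< R 1+k<n match)) (proj₁ (match-alive R match)) (proj₁ (match-⊲ R match)) fe

      placed′ : ∀ {l w} → Match j k l w → ∀ t → Placed c (g [ l ≔ x ]) n (L′ t)
      placed′ {l} match = update-all (Placed c (g [ l ≔ x ]) n) L s (outer c x)
        (λ t → placed-set (proj₁ (match-alive R match)) (pl t))
        (outer (proj₁ (match-< R 1+k<n match)) (set-same g l x))

      Result : Set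
      Result = ∃[ g′ ] ∃[ j′ ] Round g′ j′ (suc k) × State c g′ n (acc + (β + δ)) (suc cost) (suc fixed)

      far : ¬ (L s ⊲ outer c x) → (∀ a → a ⊲ L s → ¬ (a ⊲ outer c x)) → Result
      far ⋪ none = _ , _ , next-round R second-loses , weaken ≤-refl (n≤1+n _)
        (state (track S tr (price-far-outer (kind (pl s)) (elsewhere S) ⋪ none)) (separate S) (placed′ second-loses) (feasible′ second-loses) le)

      vacant-after : ∀ {v} → L s ≡ v → v ≢ source → ¬ Occupied L′ v
      vacant-after refl ≢source = vacated sep ≢source (elsewhere S)

      track-near : ∀ {v} → L s ≡ v → IsOuter v → Track (outer c x ∷ σ) L′ (acc + δ)
      track-near refl o = track S tr (price-near-outer o (elsewhere S))

      swap-prices : acc + (β + δ) ≤ acc + δ + β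
      swap-prices = ≤-reflexive (trans (cong (λ k → acc + k) (+-comm β δ)) (sym (+-assoc acc δ β)))

      -- The inner node just vacated is declared the winner: its offline server stays, so the
      -- repeated request is free offline.
      beaten : ∀ {l w} → Match j k l w → L s ≡ inner c w → Result
      beaten {l} {w} match eq = _ , _ , next-round R match ,
        weaken (≤-reflexive (sym (+-assoc acc β δ))) ≤-refl
        (answer-inner ≤-refl (proj₂ (match-< R 1+k<n match))
          (pending (track S tr (price-outer (kind (pl s)) refl (elsewhere S))) (separate S) (placed′ match)
            (vacant-after eq λ ())
            (subst (λ v → Feasible c (g [ l ≔ x ]) n F (v ∷ outer c x ∷ σ) (suc cost))
              (cong (maybe (outer c) (inner c w)) (trans (set-other g l x (≢-sym (loser≢winner R match))) (proj₂ (match-alive R match))))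
              (feasible-pos (proj₂ (match-< R 1+k<n match)) (feasible′ match)))
            le))

      inner-far : ∀ {c′ l} → L s ≡ inner c′ l → ¬ (inner c′ l ⊲ outer c x) → Result
      inner-far eq ⋪ = far (λ e → ⋪ (subst (_⊲ outer c x) eq e)) λ a e f →
        1+n≢n (trans (⊲-layer f) (sym (trans (cong layer (sym eq)) (⊲-layer e))))

      outer-⋪ : ∀ {v} → L s ≡ v → IsOuter v → ¬ (L s ⊲ outer c x)
      outer-⋪ refl o e = 1+n≢n (trans (cong suc (sym o)) (sym (⊲-layer e)))

      old-outer : ∀ {v} → L s ≡ v → IsOuter v → Old c v → Result
      old-outer {v} eq o ov with em {∃[ t ] t < q × v ≡ W c t}
      ... | no new = far (outer-⋪ eq o) λ a e f → new (old-near-outer ov (subst (a ⊲_) eq e) f)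
      ... | yes (t , t<q , v≡W) = _ , _ , next-round R second-loses , weaken swap-prices ≤-refl
        (again-W ≤-refl t<q (track-near eq o) (separate S) (placed′ second-loses)
          (subst (λ w → ¬ Occupied L′ w) v≡W (vacant-after eq (outer≢source o)))
          (subst (Placed c _ n) v≡W (old ov)) (feasible′ second-loses) le)

      by : ∀ v → L s ≡ v → Placed c g n v → Result
      by v eq origin = far (λ e → 0≢1+n (suc-injective (trans (sym (trans (⊲-layer e) (cong (λ w → suc (layer w)) eq))) refl)))
                           λ a e f → 0≢1+n (trans (cong layer (sym eq)) (⊲-layer e))
      by v eq (old base)       = old-outer eq refl base
      by v eq (old (outer lt)) = old-outer eq refl (outer lt)
      by v eq (old (inner lt)) = inner-far eq (old-inner-⋪-outer lt)
      by v eq (inner {l} l<n) with l ≟ j | l ≟ suc k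
      ... | yes refl | _        = beaten second-loses eq
      ... | no _     | yes refl = beaten first-loses eq
      ... | no l≢j   | no l≢1+k = inner-far eq (inner-⋪-outer l≢j l≢1+k)
      by v eq (outer {l} l<n gl) = _ , _ , next-round R second-loses , weaken swap-prices ≤-refl
        (again-outer l<n (trans (set-other g (suc k) x l≢) gl) (track-near eq refl) (separate S) (placed′ second-loses)
          (vacant-after eq λ ()) (feasible′ second-loses) le)
        where
        l≢ : l ≢ suc k
        l≢ refl with trans (sym gl) (waiting R ≤-refl)
        ... | ()

    -- The winner has no opponent left, so no gain is claimed. The request only brings the last
    -- picked server to an outer node, here with both inner neighbours equal to `j`.
    final-step : ∀ {c g k j acc cost fixed} → suc k ≡ n → Round g j k → State c g n acc cost fixed →
                 ∃[ g′ ] (∀ {l} → l < n → ∃[ x ] g′ l ≡ just x) × State c g′ n acc (suc cost) fixed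
    final-step {c} {g} {k} {j} {acc} 1+k≡n R (state {σ} {L} tr sep pl fe le) = g [ j ≔ x ] , all-lost ,
      weaken (m≤m+n acc 0) ≤-refl (state (track S tr z≤n) (separate S)
        (update-all (Placed c (g [ j ≔ x ]) n) L (server S) (outer c x) (λ t → placed-set (winner R) (pl t)) (outer j<n (set-same g j x)))
        (feasible-outer j<n (winner R) inner-outer₁ fe) le)
      where
      x = k , j , j
      S = serve-lazily {σ} {L} {outer c x} sep (λ { (t , eq) → outer-vacant R (subst (Placed c g n) eq (pl t)) }) λ ()
      j<n : j < n
      j<n = ≤-trans (s≤s (j≤k R)) (≤-reflexive 1+k≡n)
      all-lost : ∀ {l} → l < n → ∃[ y ] (g [ j ≔ x ]) l ≡ just y
      all-lost {l} l<n with l ≟ j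
      ... | yes _  = x , refl
      ... | no l≢j with losers R (≤-pred (≤-trans l<n (≤-reflexive (sym 1+k≡n)))) l≢j
      ...   | y , eq , _ = y , eq

    -- Whole phases and their repetition.

    record Start (c : Context) (acc cost : ℕ) : Set where
      constructor start-with
      field
        {σ}      : Requests
        {L}      : Config
        {config} : Config
        {spent}  : ℕ
        spent≤   : spent ≤ cost
        service  : Service σ config spent
        at-W     : ∀ {s} → s < q → config s ≡ W c s
        track    : Track σ L acc
        separate : Separate L
        placed   : ∀ t → L t ≡ source ⊎ Old c (L t)

    begin-phase : ∀ {c acc cost} → Start c acc cost → State c all-inner 0 acc cost 0
    begin-phase {c} (start-with spent≤ service at-W tr sep pl) = state {F = []} tr sep (λ t → placed′ (pl t))
      (λ _ → record { spent≤ = spent≤ ; service = service ; picked = λ () ; rest = λ s<q _ → at-W s<q }) z≤n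
      where
      placed′ : ∀ {u} → u ≡ source ⊎ Old c u → Placed c all-inner 0 u
      placed′ (inj₁ refl) = origin
      placed′ (inj₂ o)    = old o

    label : Context → Config → ℕ → Maybe Label
    label c C s with em {∃[ x ] C s ≡ outer c x}
    ... | yes (x , _) = just x
    ... | no _        = nothing

    -- Only here are the picks fixed. The next context is read off the resulting configuration; a
    -- server not on an outer node of this phase was not picked, since every picked one has moved
    -- on, so it still stands on `W`.
    end-phase : ∀ {c g acc cost fixed} → fixed + n ≤ q → (∀ {l} → l < n → ∃[ x ] g l ≡ just x) →
                State c g n acc cost fixed → ∃[ c′ ] Start c′ acc cost
    end-phase {c} {g} fixed+n≤q lost (state {F = F} tr sep pl fe le)
      with missing-elements n q F (≤-trans (+-monoˡ-≤ n le) fixed+n≤q)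
    ... | e , in-range , avoids , injective = next c (label c C) ,
      start-with (spent≤ S) (service S) at-W tr sep (λ t → placed′ (pl t))
      where
      S : Schedule c g n e _ _
      S = fe (record { in-range = in-range ; avoids = avoids ; injective = injective })
      C = config S
      at-W : ∀ {s} → s < q → C s ≡ W (next c (label c C)) s
      at-W {s} s<q with em {∃[ x ] C s ≡ outer c x}
      ... | yes (_ , eq) = eq
      ... | no not-outer = rest S s<q λ { l<n refl → let x , gl = lost l<n in
        not-outer (x , trans (picked S l<n) (cong (maybe (outer c) (inner c _)) gl)) }
      placed′ : ∀ {u} → Placed c g n u → u ≡ source ⊎ Old (next c (label c C)) u
      placed′ origin           = inj₁ refl
      placed′ (old base)       = inj₂ base
      placed′ (old (inner lt)) = inj₂ (inner (m<n⇒m<1+n lt))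
      placed′ (old (outer lt)) = inj₂ (outer (m<n⇒m<1+n lt))
      placed′ (inner _)        = inj₂ (inner ≤-refl)
      placed′ (outer _ _)      = inj₂ (outer ≤-refl)

    inner-steps : ∀ {c acc cost} k → k ≤ n → State c all-inner 0 acc cost 0 →
                  State c all-inner k (acc + k * δ) (k + cost) k
    inner-steps {acc = acc} zero    _    S = weaken (≤-reflexive (+-identityʳ acc)) ≤-refl S
    inner-steps {acc = acc} (suc k) k<n S = weaken (≤-reflexive (arith acc k δ)) ≤-refl
      (inner-step k<n (inner-steps k (<⇒≤ k<n) S))
      where
      arith : ∀ a k d → a + suc k * d ≡ a + k * d + d
      arith = solve-∀

    outer-steps : ∀ {c acc cost fixed} k → suc k ≤ n → State c all-inner n acc cost fixed →
                  ∃[ g ] ∃[ j ] Round g j k × State c g n (acc + k * (β + δ)) (k + cost) (k + fixed)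
    outer-steps {acc = acc} zero    _     S = all-inner , 0 ,
      record { j≤k = z≤n ; winner = refl ; waiting = λ _ → refl ; losers = λ { z≤n 0≢0 → contradiction refl 0≢0 } } ,
      weaken (≤-reflexive (+-identityʳ acc)) ≤-refl S
    outer-steps {acc = acc} (suc k) 1+k<n S with outer-steps k (<⇒≤ 1+k<n) S
    ... | g , j , R , S′ with outer-step 1+k<n R S′
    ...   | g′ , j′ , R′ , S″ = g′ , j′ , R′ , weaken (≤-reflexive (arith acc k (β + δ))) ≤-refl S″
      where
      arith : ∀ a k d → a + suc k * d ≡ a + k * d + d
      arith = solve-∀

    -- Used with `suc k ≡ n`, as the last outer request of a phase guarantees nothing.
    gain : ℕ → ℕ
    gain k = n * δ + k * (β + δ)

    phase : ∀ {c acc cost} k → suc k ≡ n → Start c acc cost → ∃[ c′ ] Start c′ (acc + gain k) (n + n + cost)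
    phase {c} {acc} {cost} k eq S = play-final (outer-steps k (≤-reflexive eq) (inner-steps n ≤-refl (begin-phase S)))
      where
      acc′ = acc + n * δ + k * (β + δ)

      finish : ∃[ g ] (∀ {l} → l < n → ∃[ x ] g l ≡ just x) × State c g n acc′ (suc (k + (n + cost))) (k + n) →
               ∃[ c′ ] Start c′ (acc + gain k) (n + n + cost)
      finish (g , lost , S′) = map₂
        (subst₂ (Start _) (+-assoc acc (n * δ) (k * (β + δ))) (trans (cong (_+ (n + cost)) eq) (sym (+-assoc n n cost))))
        (end-phase (+-monoˡ-≤ n (+-monoˡ-≤ n (≤-trans (n≤1+n k) (≤-reflexive eq)))) lost S′)

      play-final : ∃[ g ] ∃[ j ] Round g j k × State c g n acc′ (k + (n + cost)) (k + n) →
                   ∃[ c′ ] Start c′ (acc + gain k) (n + n + cost)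
      play-final (g , j , R , S′) = finish (final-step eq R S′)

    -- Places the offline servers on the base nodes. No online cost is claimed, and the offline cost
    -- goes into the additive constant.
    record Opening (k : ℕ) : Set where
      constructor opening
      field
        {σ}      : Requests
        {L}      : Config
        {config} : Config
        {spent}  : ℕ
        service  : Service σ config spent
        at-base  : ∀ {s} → s < k → config s ≡ base s
        track    : Track σ L 0
        separate : Separate L
        placed   : ∀ t → L t ≡ source ⊎ ∃[ s ] s < k × L t ≡ base s

    opening-step : ∀ {k} → Opening k → Opening (suc k)
    opening-step {k} (opening {σ} {L} {C} service at-base tr sep pl) =
      opening (serve service (base k) ((k , base k) ∷ []) (k , moved C k (base k))) at-base′
        (track S {b = 0} tr z≤n) (separate S)
        (update-all (λ v → v ≡ source ⊎ ∃[ s ] s < suc k × v ≡ base s) L (server S) (base k)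
          (λ t → weaken-place (pl t)) (inj₂ (k , ≤-refl , refl)))
      where
      weaken-place : ∀ {v} → v ≡ source ⊎ ∃[ s ] s < k × v ≡ base s → v ≡ source ⊎ ∃[ s ] s < suc k × v ≡ base s
      weaken-place (inj₁ eq)             = inj₁ eq
      weaken-place (inj₂ (s , s<k , eq)) = inj₂ (s , m<n⇒m<1+n s<k , eq)
      not-placed : ¬ (base k ≡ source ⊎ ∃[ s ] s < k × base k ≡ base s)
      not-placed (inj₂ (_ , k<k , refl)) = <-irrefl refl k<k
      S = serve-lazily {σ} {L} {base k} sep
        (λ { (t , eq) → not-placed (subst (λ v → v ≡ source ⊎ ∃[ s ] s < k × v ≡ base s) eq (pl t)) }) λ ()
      at-base′ : ∀ {s} → s < suc k → (C [ k ↦ base k ]) s ≡ base s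
      at-base′ {s} s<1+k with k ≟ s
      ... | yes refl = refl
      ... | no k≢s   = at-base (≤∧≢⇒< (≤-pred s<1+k) (≢-sym k≢s))

    openings : ∀ k → Opening k
    openings zero    = opening start (λ ())
      (λ N → ≤-reflexive (trans (+-identityʳ _) (Σ<-zero N (λ _ → dist-self source))))
      (λ _ ≢source → contradiction refl ≢source) (λ _ → inj₁ refl)
    openings (suc k) = opening-step (openings k)

    first-start : (S : Opening q) → Start root 0 (Opening.spent S)
    first-start (opening service at-base tr sep pl) = start-with ≤-refl service at-base tr sep (λ t → old-base (pl t))
      where
      old-base : ∀ {v} → v ≡ source ⊎ ∃[ s ] s < q × v ≡ base s → v ≡ source ⊎ Old root v
      old-base (inj₁ eq)             = inj₁ eq
      old-base (inj₂ (s , _ , refl)) = inj₂ base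

    phases : ∀ {c N} k T → suc k ≡ n → Start c 0 N → ∃[ c′ ] Start c′ (T * gain k) (T * (n + n) + N)
    phases         k zero    eq S = _ , S
    phases {N = N} k (suc T) eq S = one-more (phases k T eq S)
      where
      one-more : ∃[ c′ ] Start c′ (T * gain k) (T * (n + n) + N) → ∃[ c′ ] Start c′ (suc T * gain k) (suc T * (n + n) + N)
      one-more (c′ , S′) = map₂
        (subst₂ (Start _) (+-comm (T * gain k) (gain k)) (sym (+-assoc (n + n) (T * (n + n)) N))) (phase k eq S′)

    adversary : ∀ k → suc k ≡ n → ∃[ N ] (∀ T → ∃[ σ ] T * gain k ≤ ALG A σ × OPT σ ≤ T * (n + n) + N)
    adversary k eq = _ , λ T → wins (proj₂ (phases k T eq (first-start (openings q))))
      where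
      wins : ∀ {c acc cost} → Start c acc cost → ∃[ σ ] acc ≤ ALG A σ × OPT σ ≤ cost
      wins (start-with {σ} {config = C} spent≤ service _ tr _ _) =
        σ , tr 0 , ≤-trans (proj₂ (proj₂ (optimal σ)) _ (C , service)) spent≤

-- From rational bounds to inequalities between natural numbers.

fromℕ : ℕ → ℚ
fromℕ n = + n / 1

affine-≃ : ∀ ρ x c → toℚᵘ (ρ ℚ.* fromℕ x ℚ.+ c) ℚᵘ.≃ toℚᵘ ρ ℚᵘ.* mkℚᵘ (+ x) 0 ℚᵘ.+ toℚᵘ c
affine-≃ ρ x c = ℚᵘ.≃-trans (ℚ.toℚᵘ-homo-+ (ρ ℚ.* fromℕ x) c) (ℚᵘ.+-congˡ (toℚᵘ c)
  (ℚᵘ.≃-trans (ℚ.toℚᵘ-homo-* ρ (fromℕ x)) (ℚᵘ.*-congˡ {toℚᵘ ρ} (ℚ.toℚᵘ-fromℚᵘ (mkℚᵘ (+ x) 0)))))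

2a≤rb⇒a≤[r/2]b : ∀ a b r → 2 * a ≤ r * b → fromℕ a ℚ.≤ (+ r / 2) ℚ.* fromℕ b ℚ.+ 0ℚ
2a≤rb⇒a≤[r/2]b a b r le = ℚ.toℚᵘ-cancel-≤ (ℚᵘ.≤-respˡ-≃ (ℚᵘ.≃-sym (ℚ.toℚᵘ-fromℚᵘ (mkℚᵘ (+ a) 0)))
  (ℚᵘ.≤-respʳ-≃ (ℚᵘ.≃-sym (ℚᵘ.≃-trans (affine-≃ (+ r / 2) b 0ℚ)
      (ℚᵘ.+-congˡ (toℚᵘ 0ℚ) (ℚᵘ.*-congʳ {mkℚᵘ (+ b) 0} (ℚ.toℚᵘ-fromℚᵘ (mkℚᵘ (+ r) 1))))))
    (*≤* (begin
      + a ℤ.* + 2                                       ≡⟨ ℤ.pos-* a 2 ⟨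
      + (a * 2)                                         ≤⟨ ℤ.+≤+ (subst (_≤ r * b) (*-comm 2 a) le) ⟩
      + (r * b)                                         ≡⟨ ℤ.pos-* r b ⟩
      + r ℤ.* + b                                       ≡⟨ clear (+ r) (+ b) ⟩
      (+ r ℤ.* + b ℤ.* + 1 ℤ.+ + 0 ℤ.* + 2) ℤ.* + 1     ∎))))
  where
  open ℤ.≤-Reasoning
  clear : ∀ x y → x ℤ.* y ≡ (x ℤ.* y ℤ.* + 1 ℤ.+ + 0 ℤ.* + 2) ℤ.* + 1
  clear = ℤ-Solver.solve-∀

-- The positive part of an integer.
⌊_⌋⁺ : ℤ → ℕ
⌊ + a ⌋⁺      = a
⌊ -[1+ _ ] ⌋⁺ = 0

≤⌊⌋⁺ : ∀ i → i ℤ.≤ + ⌊ i ⌋⁺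
≤⌊⌋⁺ (+ _)    = ℤ.≤-refl
≤⌊⌋⁺ -[1+ _ ] = ℤ.-≤+

-- Multiplies by both denominators; negative numerators may be raised to zero because they occur
-- only in the upper bound.
clear-denominators : ∀ ρ c x y → fromℕ x ℚ.≤ ρ ℚ.* fromℕ y ℚ.+ c →
  ↧ₙ c * (↧ₙ ρ * x) ≤ ↧ₙ c * (⌊ ↥ ρ ⌋⁺ * y) + ⌊ ↥ c ⌋⁺ * ↧ₙ ρ
clear-denominators ρ@record{} c@record{} x y le
  with ℚᵘ.≤-respʳ-≃ (affine-≃ ρ y c) (ℚᵘ.≤-respˡ-≃ (ℚ.toℚᵘ-fromℚᵘ (mkℚᵘ (+ x) 0)) (ℚ.toℚᵘ-mono-≤ le))
... | *≤* le′ = ℤ.drop‿+≤+ (begin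
  + (d * (b * x))                                              ≡⟨ trans (cong +_ (regroup d b x)) (ℤ.pos-* x (b * 1 * d)) ⟩
  + x ℤ.* + (b * 1 * d)                                        ≤⟨ le′ ⟩
  ((↥ ρ ℤ.* + y) ℤ.* + d ℤ.+ ↥ c ℤ.* + (b * 1)) ℤ.* + 1        ≡⟨ drop-unit (↥ ρ) (+ y) (+ d) (↥ c) (+ (b * 1)) ⟩
  ↥ ρ ℤ.* (+ y ℤ.* + d) ℤ.+ ↥ c ℤ.* + (b * 1)                  ≡⟨ cong₂ (λ i j → ↥ ρ ℤ.* i ℤ.+ ↥ c ℤ.* + j) (sym (ℤ.pos-* y d)) (*-identityʳ b) ⟩
  ↥ ρ ℤ.* + (y * d) ℤ.+ ↥ c ℤ.* + b                            ≤⟨ ℤ.+-mono-≤ (ℤ.*-monoʳ-≤-nonNeg (+ (y * d)) (≤⌊⌋⁺ (↥ ρ))) (ℤ.*-monoʳ-≤-nonNeg (+ b) (≤⌊⌋⁺ (↥ c))) ⟩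
  + ⌊ ↥ ρ ⌋⁺ ℤ.* + (y * d) ℤ.+ + ⌊ ↥ c ⌋⁺ ℤ.* + b              ≡⟨ cong₂ ℤ._+_ (sym (ℤ.pos-* ⌊ ↥ ρ ⌋⁺ (y * d))) (sym (ℤ.pos-* ⌊ ↥ c ⌋⁺ b)) ⟩
  + (⌊ ↥ ρ ⌋⁺ * (y * d)) ℤ.+ + (⌊ ↥ c ⌋⁺ * b)                  ≡⟨ ℤ.pos-+ (⌊ ↥ ρ ⌋⁺ * (y * d)) (⌊ ↥ c ⌋⁺ * b) ⟨
  + (⌊ ↥ ρ ⌋⁺ * (y * d) + ⌊ ↥ c ⌋⁺ * b)                        ≡⟨ cong (λ k → + (k + ⌊ ↥ c ⌋⁺ * b)) (rotate ⌊ ↥ ρ ⌋⁺ y d) ⟩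
  + (d * (⌊ ↥ ρ ⌋⁺ * y) + ⌊ ↥ c ⌋⁺ * b)                        ∎)
  where
  open ℤ.≤-Reasoning
  b = ↧ₙ ρ
  d = ↧ₙ c
  regroup : ∀ d b x → d * (b * x) ≡ x * (b * 1 * d)
  regroup = solve-∀
  rotate : ∀ a y d → a * (y * d) ≡ d * (a * y)
  rotate = solve-∀
  drop-unit : ∀ r y d c b → ((r ℤ.* y) ℤ.* d ℤ.+ c ℤ.* b) ℤ.* + 1 ≡ r ℤ.* (y ℤ.* d) ℤ.+ c ℤ.* b
  drop-unit = ℤ-Solver.solve-∀

scaled-<⇒⌊⌋⁺-< : ∀ i e t b → 0 < t * b → i ℤ.* + e ℤ.< + t ℤ.* + b → e * ⌊ i ⌋⁺ < t * b
scaled-<⇒⌊⌋⁺-< (+ a) e t b _ lt = ℤ.drop‿+<+ (subst₂ ℤ._<_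
  (trans (sym (ℤ.pos-* a e)) (cong +_ (*-comm a e))) (sym (ℤ.pos-* t b)) lt)
scaled-<⇒⌊⌋⁺-< -[1+ _ ] e t b pos _ = subst (_< t * b) (sym (*-zeroʳ e)) pos

-- Each phase gains b · gain − a · (n + n) ≥ 1 on the claimed ratio a / b, so
-- enough phases exceed any additive constant.
ratio-unbounded : ∀ a b d {K N} n gain → 1 ≤ d → suc (a * (n + n)) ≤ b * gain →
  ¬ (∀ T → ∃[ x ] ∃[ y ] T * gain ≤ x × y ≤ T * (n + n) + N × d * (b * x) ≤ d * (a * y) + K)
ratio-unbounded a b d {K} {N} n gain 1≤d wins bounded
  with bounded (suc (d * (a * N) + K))
... | x , y , gain≤x , y≤ , le = <-irrefl refl (+-cancelˡ-≤ (T * (d * (a * (n + n)))) _ _ (begin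
  T * (d * (a * (n + n))) + T           ≤⟨ +-monoʳ-≤ (T * (d * (a * (n + n)))) (≤-trans (≤-reflexive (sym (*-identityʳ T))) (*-monoʳ-≤ T 1≤d)) ⟩
  T * (d * (a * (n + n))) + T * d       ≡⟨ r₁ T d (a * (n + n)) ⟩
  d * (T * suc (a * (n + n)))           ≤⟨ *-monoʳ-≤ d (*-monoʳ-≤ T wins) ⟩
  d * (T * (b * gain))                  ≡⟨ r₂ d T b gain ⟩
  d * (b * (T * gain))                  ≤⟨ *-monoʳ-≤ d (*-monoʳ-≤ b gain≤x) ⟩
  d * (b * x)                           ≤⟨ le ⟩
  d * (a * y) + K                       ≤⟨ +-monoˡ-≤ K (*-monoʳ-≤ d (*-monoʳ-≤ a y≤)) ⟩
  d * (a * (T * (n + n) + N)) + K       ≡⟨ r₃ d a T (n + n) N K ⟩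
  T * (d * (a * (n + n))) + (d * (a * N) + K) ∎))
  where
  open ≤-Reasoning
  T = suc (d * (a * N) + K)
  r₁ : ∀ T d m → T * (d * m) + T * d ≡ d * (T * suc m)
  r₁ = solve-∀
  r₂ : ∀ d T b g → d * (T * (b * g)) ≡ d * (b * (T * g))
  r₂ = solve-∀
  r₃ : ∀ d a T m N K → d * (a * (T * m + N)) + K ≡ T * (d * (a * m)) + (d * (a * N) + K)
  r₃ = solve-∀

-- Lower bound for every ratio below (β + 2 δ) / 2.

module LowerBound (em : ExcludedMiddle 0ℓ) {m} (prices : Prices m) where
  open Prices prices
  open InfiniteServer em using (OnlineAlgorithm; Competitive)

  -- The strict hypothesis yields a surplus of at least 1 for each of the `n` inner nodes. The
  -- unpaid last outer request costs `b * (β + δ)` of it, and `n` is chosen one larger.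
  gain-suffices : ∀ a b → 2 * a < (β + δ + δ) * b →
    let k = b * (β + δ) ; n = suc k in suc (a * (n + n)) ≤ b * (n * δ + k * (β + δ))
  gain-suffices a b lt = +-cancelʳ-≤ k _ _ (begin
    suc (a * (n + n)) + k             ≡⟨ r₁ a k ⟩
    n * suc (2 * a)                   ≤⟨ *-monoʳ-≤ n lt ⟩
    n * ((β + δ + δ) * b)             ≡⟨ r₂ k b β δ ⟩
    b * (n * δ + k * (β + δ)) + b * (β + δ) ∎)
    where
    open ≤-Reasoning
    k = b * (β + δ)
    n = suc k
    r₁ : ∀ a k → suc (a * (suc k + suc k)) + k ≡ suc k * suc (2 * a)
    r₁ = solve-∀
    r₂ : ∀ k b β δ → suc k * ((β + δ + δ) * b) ≡ b * (suc k * δ + k * (β + δ)) + b * (β + δ)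
    r₂ = solve-∀

  lower-bound : ∀ ρ → 2 * ⌊ ↥ ρ ⌋⁺ < (β + δ + δ) * ↧ₙ ρ →
    Σ[ G ∈ LayeredGraph (2 + m) ] (ReachesDepth (2 + m) G × ((A : OnlineAlgorithm G) → ¬ Competitive G ρ A))
  lower-bound ρ lt = G , reachesDepth , not-competitive
    where
    a = ⌊ ↥ ρ ⌋⁺
    b = ↧ₙ ρ
    -- The graph depends on `ρ` only and is fixed before the algorithm is given.
    k = b * (β + δ)
    n = suc k
    open Arena m (n + n + n)
    open InfiniteServer em G using (ALG; OPT)
    not-competitive : (A : OnlineAlgorithm G) → ¬ Competitive G ρ A
    not-competitive A (c , comp) = ratio-unbounded a b (↧ₙ c) n (n * δ + k * (β + δ)) (s≤s z≤n) (gain-suffices a b lt) λ T →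
      let σ , gain≤ , ≤cost = proj₂ adversary-plays T in
      ALG A σ , OPT σ , gain≤ , ≤cost , clear-denominators ρ c (ALG A σ) (OPT σ) (comp σ)
      where
      adversary-plays = Game.Against.adversary em m n prices A k refl

-- Prices for each depth, and the competitive ratios.

-- `source-outer` and `source-inner` bound `β + 2 * δ` by `3 + 2 * m`, which is attained here and in
-- `layers-3`.
layers-2 : Prices 0
layers-2 = record
  { β = 1 ; γ = 1 ; δ = 1 ; θ = 0
  ; source-outer = ≤-refl ; source-inner = ≤-refl ; inner-outer = ≤-refl ; inner≁outer = s≤s (s≤s z≤n)
  ; inner-inner = s≤s z≤n ; outer-outer = s≤s z≤n ; outer-inner = ≤-refl ; outer≁inner = s≤s z≤n ; detour = s≤s z≤n }

layers-3 : Prices 1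
layers-3 = record
  { β = 1 ; γ = 1 ; δ = 2 ; θ = 0
  ; source-outer = ≤-refl ; source-inner = ≤-refl ; inner-outer = ≤-refl ; inner≁outer = ≤-refl
  ; inner-inner = ≤-refl ; outer-outer = s≤s z≤n ; outer-inner = ≤-refl ; outer≁inner = s≤s (s≤s z≤n) ; detour = ≤-refl }

-- `outer-outer` and `inner-inner` cap `β` and `δ` at 2. Then `β = 2` forces `θ = 1` and `γ = 0`
-- through `inner-outer` and `outer-inner`.
layers-≥4 : ∀ {m} → 2 ≤ m → Prices m
layers-≥4 2≤m = record
  { β = 2 ; γ = 0 ; δ = 2 ; θ = 1
  ; source-outer = s≤s (s≤s 2≤m) ; source-inner = s≤s 2≤m ; inner-outer = ≤-refl ; inner≁outer = ≤-refl
  ; inner-inner = ≤-refl ; outer-outer = ≤-refl ; outer-inner = ≤-refl ; outer≁inner = ≤-refl ; detour = ≤-refl }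

theorem8 : (em : ExcludedMiddle 0ℓ) →
    let open InfiniteServer em in
    ((G : LayeredGraph 2) → ∃[ A ] Competitive G (+ 3 / 2) A)
    × ((ρ : ℚ) → ρ ℚ.< + 3 / 2 →
    Σ[ G ∈ LayeredGraph 2 ] (ReachesDepth 2 G × ((A : OnlineAlgorithm G) → ¬ Competitive G ρ A)))
    × ((G : LayeredGraph 3) → ∃[ A ] Competitive G (+ 5 / 2) A)
    × ((ρ : ℚ) → ρ ℚ.< + 5 / 2 →
    Σ[ G ∈ LayeredGraph 3 ] (ReachesDepth 3 G × ((A : OnlineAlgorithm G) → ¬ Competitive G ρ A)))
    × ((D : ℕ) → 4 ≤ D → (ρ : ℚ) → ρ ℚ.< + 3 / 1 →
    Σ[ G ∈ LayeredGraph D ] (ReachesDepth D G × ((A : OnlineAlgorithm G) → ¬ Competitive G ρ A)))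
theorem8 em =
    (λ G → upper 1 ≤-refl G)
  , (λ ρ ρ< → LowerBound.lower-bound em layers-2 ρ (scaled-<⇒⌊⌋⁺-< (↥ ρ) 2 3 (↧ₙ ρ) (s≤s z≤n) (ℚ.drop-*<* ρ<)))
  , (λ G → upper 2 (s≤s z≤n) G)
  , (λ ρ ρ< → LowerBound.lower-bound em layers-3 ρ (scaled-<⇒⌊⌋⁺-< (↥ ρ) 2 5 (↧ₙ ρ) (s≤s z≤n) (ℚ.drop-*<* ρ<)))
  , λ { (suc (suc m)) (s≤s (s≤s 2≤m)) ρ ρ< → LowerBound.lower-bound em (layers-≥4 2≤m) ρ (below-3 ρ (ℚ.drop-*<* ρ<)) }
  where
  upper : ∀ E → 1 ≤ E → (G : LayeredGraph (suc E)) →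
          ∃[ A ] InfiniteServer.Competitive em G (+ suc (2 * E) / 2) A
  upper E 1≤E G = algorithm , 0ℚ , λ σ → 2a≤rb⇒a≤[r/2]b (ALG algorithm σ) (OPT σ) (suc (2 * E)) (competitive σ)
    where
    open FreshServers em 1≤E G
    open InfiniteServer em G using (ALG; OPT)

  below-3 : ∀ ρ → ↥ ρ ℤ.* + 1 ℤ.< + 3 ℤ.* ↧ ρ → 2 * ⌊ ↥ ρ ⌋⁺ < 6 * ↧ₙ ρ
  below-3 ρ lt = subst (2 * ⌊ ↥ ρ ⌋⁺ <_) (sym (*-assoc 2 3 (↧ₙ ρ)))
    (*-monoʳ-< 2 (subst (_< 3 * ↧ₙ ρ) (*-identityˡ _) (scaled-<⇒⌊⌋⁺-< (↥ ρ) 1 3 (↧ₙ ρ) (s≤s z≤n) lt)))
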